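{- Let $G$ be a simple graph on $n$ vertices with maximum degree $\Delta(G)$ and minimum degree $\delta(G)$, and suppose $G$ is $\Delta$-critical. If $\Delta(G)-\frac{5\delta(G)}{3}\ge\frac{2n-7}{3}$, then $G$ is overfull, i.e. $|E(G)|>\Delta(G)\lfloor n/2\rfloor$.
   Context: All graphs are finite, simple and connected. The chromatic index $\chi'(G)$ is the least $k$ such that $G$ has a proper $k$-edge-coloring (adjacent edges get distinct colors). A graph $G$ is $\Delta$-critical if $\chi'(G)=\Delta(G)+1$ and $\chi'(H)<\chi'(G)$ for every proper subgraph $H$ of $G$. A graph $G$ on $n$ vertices is overfull if $|E(G)|>\Delta(G)\lfloor n/2\rfloor$. -}

module Defs where

open import Data.Nat using (ℕ; zero; suc; _+_; _*_; _⊔_; _⊓_; _<ᵇ_)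
open import Data.Bool using (Bool; true; false; _∧_)
open import Data.Fin using (Fin; toℕ)
open import Data.List using (List; map; foldr; filterᵇ; length; allFin)
open import Data.Nat.ListAction using (sum)
open import Data.Product using (_×_; Σ; ∃)
open import Data.Sum using (_⊎_)
open import Relation.Binary.PropositionalEquality using (_≡_; _≢_)
open import Relation.Nullary using (¬_)

record Graph (n : ℕ) : Set where
  field
    adj    : Fin n → Fin n → Bool
    sym    : ∀ i j → adj i j ≡ adj j i
    irrefl : ∀ i → adj i i ≡ false
open Graph public

deg : ∀ {n} → Graph n → Fin n → ℕ
deg {n} G i = length (filterᵇ (adj G i) (allFin n))

maxDeg : ∀ {n} → Graph n → ℕ
maxDeg {n} G = foldr _⊔_ 0 (map (deg G) (allFin n))

minDeg : ∀ {n} → Graph n → ℕ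
minDeg {zero}  G = 0
minDeg {suc n} G = foldr _⊓_ (deg G Fin.zero) (map (deg G) (allFin (suc n)))
  where import Data.Fin as Fin

numEdges : ∀ {n} → Graph n → ℕ
numEdges {n} G =
  sum (map (λ i → length (filterᵇ (λ j → (toℕ i <ᵇ toℕ j) ∧ adj G i j) (allFin n))) (allFin n))

data Walk {n : ℕ} (G : Graph n) : Fin n → Fin n → Set where
  here : ∀ {i} → Walk G i i
  step : ∀ {i j k} → adj G i j ≡ true → Walk G j k → Walk G i k

Connected : ∀ {n} → Graph n → Set
Connected {n} G = ∀ (i j : Fin n) → Walk G i j

EdgeColouring : ∀ {n} → (Fin n → Fin n → Bool) → ℕ → Set
EdgeColouring {n} E k =
  Σ (∀ (i j : Fin n) → E i j ≡ true → Fin k) λ c →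
    (∀ i j (p : E i j ≡ true) (q : E j i ≡ true) → c i j p ≡ c j i q) ×
    (∀ i j l (p : E i j ≡ true) (q : E i l ≡ true) → j ≢ l → c i j p ≢ c i l q)

EdgeColourable : ∀ {n} → (Fin n → Fin n → Bool) → ℕ → Set
EdgeColourable E k = EdgeColouring E k

-- A subgraph of G: a vertex subset V and an edge set E ⊆ E(G) whose edges
-- have both ends in V (E symmetric).
record Subgraph {n : ℕ} (G : Graph n) : Set where
  field
    V      : Fin n → Bool
    E      : Fin n → Fin n → Bool
    E-sym  : ∀ i j → E i j ≡ E j i
    E⊆G    : ∀ i j → E i j ≡ true → adj G i j ≡ true
    E⊆V    : ∀ i j → E i j ≡ true → V i ≡ true
open Subgraph public

ProperSubgraph : ∀ {n} → (G : Graph n) → Subgraph G → Set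
ProperSubgraph {n} G H =
  (∃ λ (i : Fin n) → V H i ≡ false) ⊎
  (∃ λ (i : Fin n) → ∃ λ (j : Fin n) → adj G i j ≡ true × E H i j ≡ false)

ChromaticIndexIsΔ+1 : ∀ {n} → Graph n → Set
ChromaticIndexIsΔ+1 G =
  EdgeColourable (adj G) (suc (maxDeg G)) × ¬ EdgeColourable (adj G) (maxDeg G)

-- Δ-critical: χ'(G) = Δ(G)+1 and χ'(H) < χ'(G) (i.e. χ'(H) ≤ Δ(G)) for every proper subgraph H
ΔCritical : ∀ {n} → Graph n → Set
ΔCritical G =
  ChromaticIndexIsΔ+1 G ×
  (∀ (H : Subgraph G) → ProperSubgraph G H → EdgeColourable (E H) (maxDeg G))

{-# OPTIONS --safe #-}

-- Let x have minimum degree δ, and colour G − xy with Δ colours. It suffices that no colour is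
-- missing at two vertices: each of the Δ colour classes then has at least ⌊n/2⌋ edges, and xy is
-- one edge more. Let b be missing at y and let xc be the edge of colour b. In G − xy − xc the
-- vertices y and c both miss b, and x misses Δ − δ + 2 colours; apart from b call these large.
-- Suppose that another vertex u misses one of the colours missing at x.
--   * If u has many edges of large colours, some w is joined to y, c and u by large colours, and
--     the kite on x, y, c, w, u can be recoloured by Kempe changes until it extends to G.
--   * Otherwise u misses many large colours. It has a neighbour s along a large colour, and
--     d(s) + d(u) ≥ Δ + 2 forces s to have many, so some w is joined to y, c and s by large
--     colours, and the kite on x, y, c, w, s with the pendant edge su extends to G.
-- In between, a Kierstead path x, y, w, u shows that a vertex sharing a large-coloured neighbour
-- with y misses at most one large colour. A colour missing at two vertices but not at x is brought
-- to this situation by a Kempe change with b.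

module Submission where

open import Defs renaming (sym to adj-sym)
open import Axiom.UniquenessOfIdentityProofs using (module Decidable⇒UIP)
open import Data.Bool using (Bool; true; false; if_then_else_; not; _∧_; _∨_; _xor_)
open import Data.Bool.ListAction using (any)
open import Data.Bool.Properties using (∧-zeroʳ; ∧-identityʳ; ¬-not) renaming (_≟_ to _≟ᵇ_)
open import Data.Empty using (⊥; ⊥-elim)
open import Data.Fin using (Fin; zero; suc; toℕ)
open import Data.Fin.Patterns using (0F; 1F; 2F; 3F; 4F; 5F; 6F)
open import Data.Fin.Permutation.Components using (transpose)
open import Data.Fin.Properties using (_≟_; any?; toℕ-injective)
open import Data.List using (List; []; _∷_; length; filter; filterᵇ; allFin; foldr; map; tabulate)
open import Data.List.Membership.Propositional using (_∈_; _∉_)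
open import Data.List.Membership.Propositional.Properties using (∈-allFin; ∈-filter⁺)
open import Data.List.Properties using (filter-notAll; length-tabulate)
open import Data.List.Relation.Unary.All as All using (All; []; _∷_)
open import Data.List.Relation.Unary.Any as Any using (Any; here; there)
open import Data.Maybe as Maybe using (Maybe; just; nothing; is-just; maybe′)
open import Data.Maybe.Properties using (just-injective) renaming (≡-dec to maybe-≡-dec)
open import Data.Nat using (ℕ; zero; suc; _+_; _*_; _/_; _≤_; _<_; _⊔_; _⊓_; _<ᵇ_; z≤n; s≤s; s≤s⁻¹)
open import Data.Nat.DivMod using (/-monoˡ-≤; m*n/n≡m; +-distrib-/-∣ʳ)
open import Data.Nat.Divisibility using (divides-refl)
import Data.Nat.ListAction as ListAction
open import Data.Nat.Properties hiding (_≟_)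
open import Data.Nat.Tactic.RingSolver using (solve-∀)
open import Data.Product using (Σ; ∃; ∃₂; _×_; _,_; proj₁; proj₂)
open import Data.Sum as Sum using (_⊎_; inj₁; inj₂; [_,_]′; swap)
open import Data.Vec using (Vec; []; _∷_; lookup)
open import Data.Vec.Relation.Unary.All using () renaming ([] to []ᵃ; _∷_ to _∷ᵃ_)
open import Data.Vec.Relation.Unary.AllPairs using () renaming ([] to []ᵘ; _∷_ to _∷ᵘ_)
open import Data.Vec.Relation.Unary.Unique.Propositional using (Unique)
open import Data.Vec.Relation.Unary.Unique.Propositional.Properties using (lookup-injective)
open import Function using (_∘_; id; case_of_)
open import Relation.Binary.Definitions using (tri<; tri≈; tri>)
open import Relation.Binary.PropositionalEquality using (_≡_; _≢_; refl; sym; trans; cong; cong₂; subst; ≢-sym; module ≡-Reasoning)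
open import Relation.Nullary using (¬_; Dec; yes; no; does; contradiction)
open import Relation.Nullary.Decidable using (_×-dec_; _⊎-dec_; ¬?; dec-true; dec-false)
open import Algebra.Properties.CommutativeMonoid.Sum +-0-commutativeMonoid using (sum; sum-cong-≗; ∑-distrib-+; ∑-comm)

-- With `s` = Δ - δ + 1 large colours, the hypothesis is exactly 2n + 2δ ≤ 3s + 4, hence 2n ≤ 3s
-- once δ ≥ 2. This is the form in which it acts: a large colour missing at y would go to xy while
-- `b` goes to xc, so y and c have exactly s neighbours along large colours, and two sets of size s
-- and one of size at least s - 1 cannot spread over n vertices without a common element. The colour
-- `b` is not large because it is missing at x, y and c at once; it is the spare colour of the Kempe
-- changes.
--
-- Those changes are the obstacle. Each one branches on where a chain ends, the branches nest, and
-- only some of the missing colours are known. They are therefore written as certificates in a small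
-- language with a Boolean checker. Its soundness is proved once, after which each configuration is
-- settled by evaluation.

private variable
  n k t m : ℕ

-- Partial edge colourings

-- `nothing` stands for non-edges and for uncoloured edges alike; the graph enters through a
-- separate edge relation. Deleting an edge and uncolouring it are thus the same operation.
Colouring : ℕ → ℕ → Set
Colouring n k = Fin n → Fin n → Maybe (Fin k)

record Proper (f : Colouring n k) : Set where
  field
    symmetric : ∀ u v → f u v ≡ f v u
    unique    : ∀ {u v w i} → f u v ≡ just i → f u w ≡ just i → v ≡ w
open Proper

Missing : Colouring n k → Fin n → Fin k → Set
Missing f u i = ∀ v → f u v ≢ just i

Present : Colouring n k → Fin n → Fin k → Set
Present f u i = ∃ λ v → f u v ≡ just i

present? : (f : Colouring n k) (u : Fin n) (i : Fin k) → Dec (Present f u i)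
present? f u i = any? λ v → maybe-≡-dec _≟_ (f u v) (just i)

missing? : (f : Colouring n k) (u : Fin n) (i : Fin k) → Present f u i ⊎ Missing f u i
missing? f u i with present? f u i
... | yes p = inj₁ p
... | no ¬p = inj₂ λ v e → ¬p (v , e)

SameEdge : (a b u v : Fin n) → Set
SameEdge a b u v = (u ≡ a × v ≡ b) ⊎ (u ≡ b × v ≡ a)

sameEdge? : (a b u v : Fin n) → Dec (SameEdge a b u v)
sameEdge? a b u v = (u ≟ a ×-dec v ≟ b) ⊎-dec (u ≟ b ×-dec v ≟ a)

sameEdge-flip : {a b u v : Fin n} → SameEdge a b u v → SameEdge a b v u
sameEdge-flip (inj₁ (p , q)) = inj₂ (q , p)
sameEdge-flip (inj₂ (p , q)) = inj₁ (q , p)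

update : Colouring n k → (a b : Fin n) → Maybe (Fin k) → Colouring n k
update f a b m u v = if does (sameEdge? a b u v) then m else f u v

module _ (f : Colouring n k) {a b : Fin n} {m : Maybe (Fin k)} where

  update-same : ∀ {u v} → SameEdge a b u v → update f a b m u v ≡ m
  update-same {u} {v} e rewrite dec-true (sameEdge? a b u v) e = refl

  update-other : ∀ {u v} → ¬ SameEdge a b u v → update f a b m u v ≡ f u v
  update-other {u} {v} e rewrite dec-false (sameEdge? a b u v) e = refl

  update-inv : ∀ {u v i} → update f a b m u v ≡ just i →
               (SameEdge a b u v × m ≡ just i) ⊎ (¬ SameEdge a b u v × f u v ≡ just i)
  update-inv {u} {v} eq with sameEdge? a b u v in d
  ... | yes e = inj₁ (e , trans (sym (update-same e)) eq)
  ... | no ¬e = inj₂ (¬e , trans (sym (update-other ¬e)) eq)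

  update-proper : Proper f → (∀ i → m ≡ just i → Missing f a i × Missing f b i) →
                  Proper (update f a b m)
  update-proper pf free .symmetric u v with sameEdge? a b u v in d
  ... | yes e = trans (update-same e) (sym (update-same (sameEdge-flip e)))
  ... | no ¬e = trans (update-other ¬e) (trans (symmetric pf u v) (sym (update-other (¬e ∘ sameEdge-flip))))
  update-proper pf free .unique {u} {v} {w} {i} p q with update-inv p | update-inv q
  ... | inj₂ (_ , p′) | inj₂ (_ , q′) = unique pf p′ q′
  ... | inj₁ (inj₁ (refl , refl) , _) | inj₁ (inj₁ (_ , refl) , _) = refl
  ... | inj₁ (inj₁ (refl , refl) , _) | inj₁ (inj₂ (refl , refl) , _) = refl
  ... | inj₁ (inj₂ (refl , refl) , _) | inj₁ (inj₁ (refl , refl) , _) = refl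
  ... | inj₁ (inj₂ (refl , refl) , _) | inj₁ (inj₂ (_ , refl) , _) = refl
  ... | inj₁ (inj₁ (refl , _) , m≡) | inj₂ (_ , q′) = ⊥-elim (proj₁ (free i m≡) w q′)
  ... | inj₁ (inj₂ (refl , _) , m≡) | inj₂ (_ , q′) = ⊥-elim (proj₂ (free i m≡) w q′)
  ... | inj₂ (_ , p′) | inj₁ (inj₁ (refl , _) , m≡) = ⊥-elim (proj₁ (free i m≡) v p′)
  ... | inj₂ (_ , p′) | inj₁ (inj₂ (refl , _) , m≡) = ⊥-elim (proj₂ (free i m≡) v p′)

  update-missing : ∀ {u i} → Missing f u i → ¬ (m ≡ just i × (u ≡ a ⊎ u ≡ b)) →
                   Missing (update f a b m) u i
  update-missing mis no-clash v e with update-inv e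
  ... | inj₁ (inj₁ (p , _) , m≡) = no-clash (m≡ , inj₁ p)
  ... | inj₁ (inj₂ (p , _) , m≡) = no-clash (m≡ , inj₂ p)
  ... | inj₂ (_ , e′) = mis v e′

without : Colouring n k → {D : Fin n → Fin n → Set} → (∀ u v → Dec (D u v)) → Colouring n k
without f D? u v = if does (D? u v) then nothing else f u v

module _ (f : Colouring n k) {D : Fin n → Fin n → Set} (D? : ∀ u v → Dec (D u v)) where

  without-same : ∀ {u v} → D u v → without f D? u v ≡ nothing
  without-same {u} {v} d rewrite dec-true (D? u v) d = refl

  without-other : ∀ {u v} → ¬ D u v → without f D? u v ≡ f u v
  without-other {u} {v} ¬d rewrite dec-false (D? u v) ¬d = refl

  without-inv : ∀ {u v i} → without f D? u v ≡ just i → ¬ D u v × f u v ≡ just i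
  without-inv {u} {v} e with D? u v
  ... | no ¬d = ¬d , e

  without-nothing : ∀ {u v} → without f D? u v ≡ nothing → D u v ⊎ f u v ≡ nothing
  without-nothing {u} {v} e with D? u v
  ... | yes d = inj₁ d
  ... | no _ = inj₂ e

  without-missing : ∀ {u i} → Missing f u i → Missing (without f D?) u i
  without-missing m v e = m v (proj₂ (without-inv e))

  module _ (pf : Proper f) where

    without-proper : (∀ {u v} → D u v → D v u) → Proper (without f D?)
    without-proper D-sym .symmetric u v = case D? u v of λ where
      (yes d) → trans (without-same d) (sym (without-same (D-sym d)))
      (no ¬d) → trans (without-other ¬d) (trans (symmetric pf u v) (sym (without-other (¬d ∘ D-sym))))
    without-proper D-sym .unique e e′ = unique pf (proj₂ (without-inv e)) (proj₂ (without-inv e′))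

    removed-missing : ∀ {u v i} → D u v → f u v ≡ just i → Missing (without f D?) u i
    removed-missing d e w e′ with ¬d , e″ ← without-inv e′ = ¬d (subst (D _) (unique pf e e″) d)

-- Kempe chains

Closed : Colouring n k → (p q : Fin k) → (Fin n → Bool) → Set
Closed f p q A = ∀ {u v i} → f u v ≡ just i → i ≡ p ⊎ i ≡ q → A u ≡ A v

End : Colouring n k → (p q : Fin k) → Fin n → Set
End f p q u = Missing f u p ⊎ Missing f u q

-- Stands for the component of `z` in the colours `p` and `q`. Connectivity is not recorded: a Kempe
-- change needs only `closed`, and its effect at other ends only `otherEnd`. The field `isolated`
-- serves the recursion that builds chains.
record Chain (f : Colouring n k) (p q : Fin k) (z : Fin n) : Set where
  field
    member   : Fin n → Bool
    closed   : Closed f p q member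
    start    : member z ≡ true
    isolated : Missing f z p → Missing f z q → ∀ {u} → member u ≡ true → u ≡ z
    otherEnd : ∀ {u v} → member u ≡ true → member v ≡ true → u ≢ z → v ≢ z →
               End f p q u → End f p q v → u ≡ v
open Chain

only : Fin n → Fin n → Bool
only z u = does (u ≟ z)

only-refl : (z : Fin n) → only z z ≡ true
only-refl z = dec-true (z ≟ z) refl

only-≢ : {u z : Fin n} → u ≢ z → only z u ≡ false
only-≢ {u = u} {z} = dec-false (u ≟ z)

only-≡ : {u z : Fin n} → only z u ≡ true → u ≡ z
only-≡ {u = u} {z} e with u ≟ z
... | yes r = r

∨-only : (A : Fin n → Bool) {u z : Fin n} → u ≢ z → only z u ∨ A u ≡ A u
∨-only A ne rewrite only-≢ ne = refl

-- Peel off the edge at the end z of the chain: its other end becomes an end of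
-- the remaining colouring, in which z is isolated.
private
  chain′ : ∀ fuel (alive : List (Fin n)) → length alive ≤ fuel → {f : Colouring n k} → Proper f →
           ∀ {p q} → (∀ {u} → u ∉ alive → Missing f u p × Missing f u q) →
           ∀ z → Missing f z p → Chain f p q z
  chain′ fuel alive bound {f} pf {p} {q} dead z zp with missing? f z q
  ... | inj₂ zq = record
    { member = only z ; closed = cl ; start = only-refl z ; isolated = λ _ _ → only-≡ ; otherEnd = oe }
    where
    cl : Closed f p q (only z)
    cl {u} {v} e i∈ with u ≟ z | v ≟ z
    ... | yes _ | yes _ = refl
    ... | no _ | no _ = refl
    cl {u} {v} e (inj₁ refl) | yes refl | no _ = ⊥-elim (zp _ e)
    cl {u} {v} e (inj₂ refl) | yes refl | no _ = ⊥-elim (zq _ e)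
    cl {u} {v} e (inj₁ refl) | no _ | yes refl = ⊥-elim (zp _ (trans (symmetric pf _ _) e))
    cl {u} {v} e (inj₂ refl) | no _ | yes refl = ⊥-elim (zq _ (trans (symmetric pf _ _) e))
    oe : ∀ {u v} → only z u ≡ true → only z v ≡ true → u ≢ z → v ≢ z → End f p q u → End f p q v → u ≡ v
    oe m _ ne _ _ _ = contradiction (trans (sym m) (only-≢ ne)) λ ()
  chain′ zero [] bound {f} pf dead z zp | inj₁ (z₁ , zz₁) = ⊥-elim (proj₂ (dead λ ()) z₁ zz₁)
  chain′ (suc fuel) alive bound {f} pf {p} {q} dead z zp | inj₁ (z₁ , zz₁) = record
    { member = A ; closed = cl ; start = st
    ; isolated = λ _ m → ⊥-elim (m _ zz₁) ; otherEnd = oe }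
    where
    D? = sameEdge? z z₁
    g = without f D?
    pg = without-proper f D? pf sameEdge-flip
    zq : Missing g z q
    zq = removed-missing f D? pf (inj₁ (refl , refl)) zz₁
    z₁q : Missing g z₁ q
    z₁q = removed-missing f D? pf (inj₂ (refl , refl)) (trans (symmetric pf z₁ z) zz₁)
    alive′ = filter (λ u → ¬? (u ≟ z)) alive
    z∈ : z ∈ alive
    z∈ with Any.any? (z ≟_) alive
    ... | yes e = e
    ... | no e = ⊥-elim (proj₂ (dead e) z₁ zz₁)
    bound′ : length alive′ ≤ fuel
    bound′ = s≤s⁻¹ (≤-trans (filter-notAll _ alive (Any.map (λ e ne → ne (sym e)) z∈)) bound)
    dead′ : ∀ {u} → u ∉ alive′ → Missing g u q × Missing g u p
    dead′ {u} u∉ = case u ≟ z of λ where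
      (yes refl) → zq , without-missing f D? zp
      (no ne) → let dp , dq = dead {u} (λ u∈ → u∉ (∈-filter⁺ _ u∈ ne)) in
                without-missing f D? dq , without-missing f D? dp
    -- The colours trade places: the deleted edge had colour `q`, so `q` is the colour that `z₁` is
    -- now known to miss.
    c = chain′ fuel alive′ bound′ pg {q} {p} dead′ z₁ z₁q
    A : Fin _ → Bool
    A u = only z u ∨ only z₁ u ∨ member c u
    st : A z ≡ true
    st rewrite only-refl z = refl
    A-z₁ : A z₁ ≡ true
    A-z₁ rewrite only-refl z₁ with only z z₁
    ... | true = refl
    ... | false = refl
    lone : ∀ {v i} → f z v ≡ just i → i ≡ p ⊎ i ≡ q → v ≡ z₁
    lone e (inj₁ refl) = ⊥-elim (zp _ e)
    lone e (inj₂ refl) = unique pf e zz₁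
    A-member : ∀ {u} → u ≢ z → A u ≡ member c u
    A-member {u} ne = trans (∨-only (λ u → only z₁ u ∨ member c u) ne) (case u ≟ z₁ of λ where
      (yes refl) → trans (cong (_∨ member c z₁) (only-refl z₁)) (sym (start c))
      (no ne₁) → ∨-only (member c) ne₁)
    cl : Closed f p q A
    cl {u} {v} e i∈ = case (u ≟ z) , (v ≟ z) of λ where
      (yes refl , _) → trans st (sym (trans (cong A (lone e i∈)) A-z₁))
      (no _ , yes refl) →
        trans (trans (cong A (lone (trans (symmetric pf _ _) e) i∈)) A-z₁) (sym st)
      (no u≢ , no v≢) → trans (A-member u≢)
        (trans (closed c (trans (without-other f D? λ { (inj₁ (r , _)) → u≢ r ; (inj₂ (_ , r)) → v≢ r }) e) (swap i∈))
               (sym (A-member v≢)))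
    oe : ∀ {u v} → A u ≡ true → A v ≡ true → u ≢ z → v ≢ z → End f p q u → End f p q v → u ≡ v
    -- If `z₁` misses `p`, the chain stops there and `z₁` is its only other end. Otherwise every
    -- other end lies beyond `z₁` and stays an end after the deletion.
    oe {u} {v} mu mv u≢ v≢ eu ev with missing? f z₁ p
    ... | inj₁ (z₂ , e₂) = otherEnd c (trans (sym (A-member u≢)) mu) (trans (sym (A-member v≢)) mv)
                              (inner eu) (inner ev) (keep eu) (keep ev)
      where
      keep : ∀ {u} → End f p q u → End g q p u
      keep (inj₁ m) = inj₂ (without-missing f D? m)
      keep (inj₂ m) = inj₁ (without-missing f D? m)
      inner : ∀ {u} → End f p q u → u ≢ z₁
      inner (inj₁ m) refl = m _ e₂
      inner (inj₂ m) refl = m _ (trans (symmetric pf _ _) zz₁)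
    ... | inj₂ m = trans (alone mu u≢) (sym (alone mv v≢))
      where
      alone : ∀ {u} → A u ≡ true → u ≢ z → u ≡ z₁
      alone mu u≢ = isolated c z₁q (without-missing f D? m) (trans (sym (A-member u≢)) mu)

chain : {f : Colouring n k} → Proper f → ∀ p q z → End f p q z → Chain f p q z
chain {n} pf p q z (inj₁ m) =
  chain′ n (allFin n) (≤-reflexive (length-tabulate id)) pf (λ u∉ → ⊥-elim (u∉ (∈-allFin _))) z m
chain {n} pf p q z (inj₂ m) = record
  { member = member c ; closed = λ e → closed c e ∘ swap ; start = start c
  ; isolated = λ mp mq → isolated c mq mp
  ; otherEnd = λ mu mv u≢ v≢ eu ev → otherEnd c mu mv u≢ v≢ (swap eu) (swap ev) }
  where c = chain′ n (allFin n) (≤-reflexive (length-tabulate id)) pf (λ u∉ → ⊥-elim (u∉ (∈-allFin _))) z m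

-- Kempe changes

module _ (p q : Fin k) where

  transpose-left : transpose p q p ≡ q
  transpose-left rewrite dec-true (p ≟ p) refl = refl

  transpose-right : transpose p q q ≡ p
  transpose-right with q ≟ p
  ... | yes e = e
  ... | no _ rewrite dec-true (q ≟ q) refl = refl

  transpose-other : ∀ {i} → i ≢ p → i ≢ q → transpose p q i ≡ i
  transpose-other {i} i≢p i≢q rewrite dec-false (i ≟ p) i≢p | dec-false (i ≟ q) i≢q = refl

  transpose-cases : (P : Fin k → Fin k → Set) → P p q → P q p → (∀ {i} → i ≢ p → i ≢ q → P i i) →
                    ∀ i → P i (transpose p q i)
  transpose-cases P pq qp other i = case i ≟ p of λ where
    (yes refl) → subst (P p) (sym transpose-left) pq
    (no i≢p) → case i ≟ q of λ where
      (yes refl) → subst (P q) (sym transpose-right) qp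
      (no i≢q) → subst (P i) (sym (transpose-other i≢p i≢q)) (other i≢p i≢q)

  transpose-involutive : ∀ i → transpose p q (transpose p q i) ≡ i
  transpose-involutive = transpose-cases (λ i j → transpose p q j ≡ i)
    transpose-right transpose-left transpose-other

-- Only the first end of an edge is tested. The result is still symmetric: `Closed` puts both ends
-- of an edge coloured `p` or `q` on one side, and the transposition fixes all other colours.
swapOn : (p q : Fin k) → (Fin n → Bool) → Colouring n k → Colouring n k
swapOn p q A f u v = if A u then Maybe.map (transpose p q) (f u v) else f u v

module _ {f : Colouring n k} {p q : Fin k} {A : Fin n → Bool} where

  swapOn-inv : ∀ {u v i} → swapOn p q A f u v ≡ just i →
               (A u ≡ true × f u v ≡ just (transpose p q i)) ⊎ (A u ≡ false × f u v ≡ just i)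
  swapOn-inv {u} {v} eq with A u
  ... | false = inj₂ (refl , eq)
  swapOn-inv {u} {v} eq | true with f u v
  swapOn-inv refl | true | just j = inj₁ (refl , cong just (sym (transpose-involutive p q j)))

  swapOn-is-just : ∀ u v → is-just (swapOn p q A f u v) ≡ is-just (f u v)
  swapOn-is-just u v with A u
  ... | false = refl
  ... | true with f u v
  ...   | just _ = refl
  ...   | nothing = refl

  swapOn-missing : ∀ {u i} → (A u ≡ true → Missing f u (transpose p q i)) →
                   (A u ≡ false → Missing f u i) → Missing (swapOn p q A f) u i
  swapOn-missing inside outside v e with swapOn-inv e
  ... | inj₁ (au , e′) = inside au v e′
  ... | inj₂ (au , e′) = outside au v e′

  swapOn-other : ∀ {u v i} → i ≢ p → i ≢ q → swapOn p q A f u v ≡ just i → f u v ≡ just i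
  swapOn-other i≢p i≢q e with swapOn-inv e
  ... | inj₁ (_ , e′) = trans e′ (cong just (transpose-other p q i≢p i≢q))
  ... | inj₂ (_ , e′) = e′

  swapOn-proper : Proper f → Closed f p q A → Proper (swapOn p q A f)
  swapOn-proper pf cl .symmetric u v =
    trans (recolour (f u v) refl)
      (cong (λ m → if A v then Maybe.map (transpose p q) m else f v u) (symmetric pf u v))
    where
    recolour : ∀ m → f u v ≡ m → swapOn p q A f u v ≡ (if A v then Maybe.map (transpose p q) (f u v) else f v u)
    recolour nothing e with A u | A v
    ... | true | true = refl
    ... | false | false = symmetric pf u v
    ... | true | false rewrite sym (symmetric pf u v) | e = refl
    ... | false | true rewrite e = refl
    recolour (just i) e = transpose-cases p q Goal (same {j = q} (inj₁ refl)) (same {j = p} (inj₂ refl)) other i e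
      where
      Goal : Fin k → Fin k → Set
      Goal i j = f u v ≡ just i → swapOn p q A f u v ≡ (if A v then Maybe.map (transpose p q) (f u v) else f v u)
      same : ∀ {i j} → i ≡ p ⊎ i ≡ q → Goal i j
      same i∈ e with A u | A v | cl e i∈
      ... | true | .true | refl = refl
      ... | false | .false | refl = symmetric pf u v
      other : ∀ {i} → i ≢ p → i ≢ q → Goal i i
      other i≢p i≢q e with A u | A v
      ... | true | true = refl
      ... | false | false = symmetric pf u v
      ... | true | false rewrite sym (symmetric pf u v) | e = cong just (transpose-other p q i≢p i≢q)
      ... | false | true rewrite e = cong just (sym (transpose-other p q i≢p i≢q))
  swapOn-proper pf cl .unique eq eq′ with swapOn-inv eq | swapOn-inv eq′
  ... | inj₁ (_ , p′) | inj₁ (_ , q′) = unique pf p′ q′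
  ... | inj₂ (_ , p′) | inj₂ (_ , q′) = unique pf p′ q′
  ... | inj₁ (a , _) | inj₂ (b , _) = contradiction (trans (sym a) b) λ ()
  ... | inj₂ (b , _) | inj₁ (a , _) = contradiction (trans (sym a) b) λ ()

∧-split : ∀ {a b} → a ∧ b ≡ true → a ≡ true × b ≡ true
∧-split {true} {true} _ = refl , refl

not-true : ∀ {a} → not a ≡ true → a ≡ false
not-true {false} _ = refl

only-false : {u z : Fin n} → only z u ≡ false → u ≢ z
only-false {z = z} e refl = contradiction (trans (sym (only-refl z)) e) λ ()

is-just-false : {A : Set} {a : Maybe A} → is-just a ≡ false → a ≡ nothing
is-just-false {a = nothing} _ = refl

every : (Fin t → Bool) → Bool
every {zero} P = true
every {suc t} P = P zero ∧ every (P ∘ suc)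

every-apply : (P : Fin t → Bool) → every P ≡ true → ∀ v → P v ≡ true
every-apply P e zero = proj₁ (∧-split e)
every-apply P e (suc v) = every-apply (P ∘ suc) (proj₂ (∧-split e)) v

-- Recolouring certificates

-- A gadget consists of t vertices and some edges between them. Lists record, for the colouring
-- with the gadget edges removed, colours that are known to be missing at its vertices.
Lists : ℕ → ℕ → Set
Lists t m = Fin t → Fin m → Bool

-- A chain in the colours left and right, known only through the gadget vertices among its ends.
record Cut (t m : ℕ) : Set where
  constructor cut
  field
    left right : Fin m
    side : Fin t → Bool

-- colour gives colours to the gadget edges, in order. follow looks at the chain of z in the colours
-- p and q, and branches on which gadget vertex, if any, is its other end. flip swaps the colours on
-- a chain followed before; afterwards only the chains in two other colours are still known.
data Cert (t m : ℕ) : Set where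
  colour : List (Fin m) → Cert t m
  follow : (p q : Fin m) (z : Fin t) (alone : Cert t m) (linked : Fin t → Cert t m) → Cert t m
  flip   : ℕ → Cert t m → Cert t m

used : (a b : Fin t) → Fin m → Lists t m → Lists t m
used a b i L v c = L v c ∧ not (only i c ∧ (only a v ∨ only b v))

colours : List (Fin t × Fin t) → Lists t m → List (Fin m) → Bool
colours [] L [] = true
colours [] L (_ ∷ _) = false
colours (_ ∷ _) L [] = false
colours ((a , b) ∷ es) L (i ∷ is) = L a i ∧ L b i ∧ colours es (used a b i L) is

-- Exactly one of the two colours is known to be missing. If both or neither are known, exchanging
-- `p` and `q` leaves the list as it is, and the side of the chain on which the vertex lies does not
-- matter.
isEnd : Lists t m → (p q : Fin m) → Fin t → Bool
isEnd L p q v = L v p xor L v q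

flipped : Cut t m → Lists t m → Lists t m
flipped (cut p q A) L v c = if A v then L v (transpose p q c) else L v c

disjoint : Cut t m → Cut t m → Bool
disjoint (cut p q _) (cut r s _) = not (only p r) ∧ not (only q r) ∧ not (only p s) ∧ not (only q s)

nth : List (Cut t m) → ℕ → Maybe (Cut t m)
nth [] _ = nothing
nth (κ ∷ κs) zero = just κ
nth (κ ∷ κs) (suc i) = nth κs i

-- The branch `alone` also covers chains that end outside the gadget, or at a gadget vertex whose
-- list does not reveal it as an end.
check : List (Fin t × Fin t) → Lists t m → List (Cut t m) → Cert t m → Bool
check es L κs (colour is) = colours es L is
check es L κs (follow p q z alone linked) =
  isEnd L p q z ∧ check es L (cut p q (only z) ∷ κs) alone ∧
  every λ o → only z o ∨ not (isEnd L p q o) ∨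
              check es L (cut p q (λ v → only z v ∨ only o v) ∷ κs) (linked o)
check es L κs (flip i c) with nth κs i
... | nothing = false
... | just κ = check es (flipped κ L) (filterᵇ (disjoint κ) κs) c

Colourable : (Fin n → Fin n → Bool) → ℕ → Set
Colourable {n} E k = ∃ λ (g : Colouring n k) → Proper g × (∀ u v → E u v ≡ true → g u v ≢ nothing)

-- Soundness of certificates

module Soundness
  (E : Fin n → Fin n → Bool)
  (vert : Fin t → Fin n) (vert-injective : ∀ {u v} → vert u ≡ vert v → u ≡ v)
  (col : Fin m → Fin k) (col-injective : ∀ {c d} → col c ≡ col d → c ≡ d)
  where

  -- Lists are only lower bounds on the missing colours, so one certificate serves every colouring
  -- that contains the configuration.
  Realises : Colouring n k → Lists t m → Set
  Realises f L = ∀ v c → L v c ≡ true → Missing f (vert v) (col c)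

  Covers : Colouring n k → List (Fin t × Fin t) → Set
  Covers f es = ∀ u v → E u v ≡ true → f u v ≡ nothing →
                Any (λ (a , b) → SameEdge (vert a) (vert b) u v) es

  colours-sound : ∀ es is {f L} → Proper f → Realises f L → Covers f es →
                  colours es L is ≡ true → Colourable E k
  colours-sound [] [] pf _ cov _ = _ , pf , λ u v e f≡ → case cov u v e f≡ of λ ()
  colours-sound ((a , b) ∷ es) (i ∷ is) {f} {L} pf real cov ok
    with Lai , ok′ ← ∧-split {L a i} ok
    with Lbi , ok″ ← ∧-split {L b i} ok′
    = colours-sound es is (update-proper f pf λ { _ refl → real a i Lai , real b i Lbi }) real′ cov′ ok″
    where
    g = update f (vert a) (vert b) (just (col i))
    real′ : Realises g (used a b i L)
    clash : ∀ {v c} → c ≡ i → v ≡ a ⊎ v ≡ b → only i c ∧ (only a v ∨ only b v) ≢ false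
    clash refl (inj₁ refl) e rewrite only-refl i | only-refl a = contradiction e λ ()
    clash refl (inj₂ refl) e rewrite only-refl i | only-refl b with only a b
    ... | true = contradiction e λ ()
    ... | false = contradiction e λ ()
    real′ v c e with Lvc , free ← ∧-split {L v c} e = update-missing f (real v c Lvc) λ (j , v≡) →
      clash (sym (col-injective (just-injective j))) (Sum.map vert-injective vert-injective v≡) (not-true free)
    cov′ : Covers g es
    cov′ u v e g≡ = case sameEdge? (vert a) (vert b) u v of λ where
      (yes s) → contradiction (trans (sym g≡) (update-same f s)) λ ()
      (no ¬s) → case cov u v e (trans (sym (update-other f ¬s)) g≡) of λ where
        (here s) → ⊥-elim (¬s s)
        (there r) → r

  Valid : Colouring n k → Lists t m → Cut t m → Set
  Valid f L (cut p q A) = ∃ λ B → Closed f (col p) (col q) B ×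
                          (∀ v → isEnd L p q v ≡ true → B (vert v) ≡ A v)

  transpose-col : ∀ p q c → transpose (col p) (col q) (col c) ≡ col (transpose p q c)
  transpose-col p q = transpose-cases p q (λ c d → transpose (col p) (col q) (col c) ≡ col d)
    (transpose-left (col p) (col q)) (transpose-right (col p) (col q))
    λ c≢p c≢q → transpose-other (col p) (col q) (c≢p ∘ col-injective) (c≢q ∘ col-injective)

  isEnd-missing : ∀ {f L} → Realises f L → ∀ p q v → isEnd L p q v ≡ true →
                  End f (col p) (col q) (vert v)
  isEnd-missing {L = L} real p q v e with L v p in Lp | L v q in Lq
  ... | true | _ = inj₁ (real v p Lp)
  ... | false | true = inj₂ (real v q Lq)

  not-isEnd : ∀ (L : Lists t m) p q v → isEnd L p q v ≡ false → L v p ≡ L v q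
  not-isEnd L p q v e with L v p | L v q
  ... | true | true = refl
  ... | false | false = refl

  module Flip {f : Colouring n k} {L : Lists t m} (pf : Proper f) (real : Realises f L) {p q A}
              (valid : Valid f L (cut p q A)) where
    κ = cut p q A
    B = proj₁ valid
    g = swapOn (col p) (col q) B f
    pg : Proper g
    pg = swapOn-proper pf (proj₁ (proj₂ valid))

    same-list : ∀ v → isEnd L p q v ≡ false → ∀ c → L v (transpose p q c) ≡ L v c
    same-list v end = transpose-cases p q (λ c d → L v d ≡ L v c)
      (sym (not-isEnd L p q v end)) (not-isEnd L p q v end) λ _ _ → refl

    -- At a recorded end the cut tells the true side. At any other vertex the list treats `p` and
    -- `q` alike, so the flipped list is correct whichever side the vertex is on.
    flip-both : ∀ v c → flipped κ L v c ≡ true →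
                (B (vert v) ≡ true → L v (transpose p q c) ≡ true) ×
                (B (vert v) ≡ false → L v c ≡ true)
    flip-both v c e with isEnd L p q v in end
    ... | true with A v | proj₂ (proj₂ valid) v end
    ...   | true | B≡ = (λ _ → e) , λ B≡′ → contradiction (trans (sym B≡) B≡′) λ ()
    ...   | false | B≡ = (λ B≡′ → contradiction (trans (sym B≡) B≡′) λ ()) , λ _ → e
    flip-both v c e | false with A v | same-list v end c
    ... | true | same = (λ _ → e) , λ _ → trans (sym same) e
    ... | false | same = (λ _ → trans same e) , λ _ → e

    real′ : Realises g (flipped κ L)
    real′ v c e = swapOn-missing {f = f} {A = B}
      (λ B≡ → subst (Missing f (vert v)) (sym (transpose-col p q c)) (real v _ (proj₁ (flip-both v c e) B≡)))
      (λ B≡ → real v c (proj₂ (flip-both v c e) B≡))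

    unaffected : ∀ {r} v → r ≢ p → r ≢ q → flipped κ L v r ≡ L v r
    unaffected v r≢p r≢q with A v
    ... | true = cong (L v) (transpose-other p q r≢p r≢q)
    ... | false = refl

    -- Swapping `p` and `q` touches neither the edges of colours `r` and `s` nor the list entries
    -- for them.
    keep : ∀ κ′ → Valid f L κ′ → disjoint κ κ′ ≡ true → Valid g (flipped κ L) κ′
    keep (cut r s _) (B′ , cl , known) d
      with d₁ , e ← ∧-split {not (only p r)} d
      with d₂ , e ← ∧-split {not (only q r)} e
      with d₃ , d₄ ← ∧-split {not (only p s)} e
      = B′ , cl′ , λ v end → known v (trans (sym (cong₂ _xor_ (unaffected v r≢p r≢q) (unaffected v s≢p s≢q))) end)
      where
      r≢p = only-false (not-true d₁)
      r≢q = only-false (not-true d₂)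
      s≢p = only-false (not-true d₃)
      s≢q = only-false (not-true d₄)
      cl′ : Closed g (col r) (col s) B′
      cl′ e (inj₁ refl) = cl (swapOn-other {f = f} {A = B} (r≢p ∘ col-injective) (r≢q ∘ col-injective) e) (inj₁ refl)
      cl′ e (inj₂ refl) = cl (swapOn-other {f = f} {A = B} (s≢p ∘ col-injective) (s≢q ∘ col-injective) e) (inj₂ refl)

    keepAll : ∀ κs → All (Valid f L) κs → All (Valid g (flipped κ L)) (filterᵇ (disjoint κ) κs)
    keepAll [] [] = []
    keepAll (κ′ ∷ κs) (v ∷ vs) with disjoint κ κ′ in d
    ... | true = keep κ′ v d ∷ keepAll κs vs
    ... | false = keepAll κs vs

    cov′ : ∀ {es} → Covers f es → Covers g es
    cov′ cov u v e g≡ = cov u v e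
      (is-just-false (trans (sym (swapOn-is-just {f = f} {col p} {col q} {B} u v)) (cong is-just g≡)))

  nth-valid : ∀ {f L} κs i {κ} → nth κs i ≡ just κ → All (Valid f L) κs → Valid f L κ
  nth-valid (κ ∷ κs) zero refl (v ∷ vs) = v
  nth-valid {f} {L} (κ ∷ κs) (suc i) e (v ∷ vs) = nth-valid {f} {L} κs i e vs

  sound : ∀ es c {f L κs} → Proper f → Realises f L → All (Valid f L) κs → Covers f es →
          check es L κs c ≡ true → Colourable E k
  sound es (colour is) pf real valid cov ok = colours-sound es is pf real cov ok
  sound es (flip i c) {f} {L} {κs} pf real valid cov ok with nth κs i in at
  ... | just (cut p q A) = sound es c pg real′ (keepAll κs valid) (cov′ cov) ok
    where open Flip {f} {L} pf real (nth-valid {f} {L} κs i at valid)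
  sound es (follow p q z alone linked) {f} {L} pf real valid cov ok
    with z-end , ok ← ∧-split {isEnd L p q z} ok
    with ok-alone , ok-linked ← ∧-split {check es L _ alone} ok
    = case any? partner? of λ where
        (yes (o , o≢z , o-end , o∈)) →
          sound es (linked o) pf real ((member ch , closed ch , known-pair o≢z o-end o∈) ∷ valid) cov
            (branch o≢z o-end (every-apply _ ok-linked o))
        (no none) →
          sound es alone pf real ((member ch , closed ch , known-alone none) ∷ valid) cov ok-alone
    where
    end : ∀ v → isEnd L p q v ≡ true → End f (col p) (col q) (vert v)
    end = isEnd-missing {f} {L} real p q
    ch = chain pf (col p) (col q) (vert z) (end z z-end)
    Partner : Fin t → Set
    Partner o = o ≢ z × isEnd L p q o ≡ true × member ch (vert o) ≡ true
    partner? : ∀ o → Dec (Partner o)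
    partner? o = ¬? (o ≟ z) ×-dec isEnd L p q o ≟ᵇ true ×-dec member ch (vert o) ≟ᵇ true
    known-alone : ¬ ∃ Partner → ∀ v → isEnd L p q v ≡ true → member ch (vert v) ≡ only z v
    known-alone none v v-end = case v ≟ z of λ where
      (yes refl) → trans (start ch) (sym (only-refl z))
      (no v≢z) → trans (¬-not λ v∈ → none (v , v≢z , v-end , v∈)) (sym (only-≢ v≢z))
    -- A third recorded end on the chain would equal `o` by `otherEnd`, so the cut is known at all
    -- recorded ends.
    known-pair : ∀ {o} → o ≢ z → isEnd L p q o ≡ true → member ch (vert o) ≡ true →
                 ∀ v → isEnd L p q v ≡ true → member ch (vert v) ≡ only z v ∨ only o v
    known-pair {o} o≢z o-end o∈ v v-end = case (v ≟ z) , (v ≟ o) of λ where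
      (yes refl , _) → trans (start ch) (sym (cong (_∨ only o z) (only-refl z)))
      (no v≢z , yes refl) → trans o∈ (sym (cong₂ _∨_ (only-≢ v≢z) (only-refl v)))
      (no v≢z , no v≢o) → trans (¬-not λ v∈ → v≢o (vert-injective (otherEnd ch v∈ o∈
                              (v≢z ∘ vert-injective) (o≢z ∘ vert-injective) (end v v-end) (end o o-end))))
                            (sym (cong₂ _∨_ (only-≢ v≢z) (only-≢ v≢o)))
    branch : ∀ {o x} → o ≢ z → isEnd L p q o ≡ true → only z o ∨ not (isEnd L p q o) ∨ x ≡ true → x ≡ true
    branch o≢z o-end e rewrite only-≢ o≢z | o-end = e

kempe : (p q : Fin m) (z : Fin t) → Cert t m → (Fin t → Cert t m) → Cert t m
kempe p q z alone linked = follow p q z (flip 0 alone) (flip 0 ∘ linked)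

infixr 1 _⇒_∣_

_⇒_∣_ : Fin t → Cert t m → (Fin t → Cert t m) → Fin t → Cert t m
(o ⇒ c ∣ rest) v = if only o v then c else rest v

-- A filler for branches that cannot occur. As `colour []` is rejected while edges remain to be
-- coloured, a branch omitted by mistake makes `check` fail.
end : Fin t → Cert t m
end _ = colour []

toLists : Vec (List (Fin m)) t → Lists t m
toLists ls v c = any (only c) (lookup ls v)

record Gadget (t m : ℕ) : Set where
  field
    edges : List (Fin t × Fin t)
    lists : Vec (List (Fin m)) t
    cert  : Cert t m
    valid : check edges (toLists lists) [] cert ≡ true
open Gadget public

-- Reducible configurations

-- In all gadgets colour 0F is b, and x misses every colour. The certificates were found by a
-- computer search.
X : Fin (1 + t)
X = 0F
Y : Fin (2 + t)
Y = 1F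
C : Fin (3 + t)
C = 2F
W : Fin (4 + t)
W = 3F
U : Fin (5 + t)
U = 4F
T : Fin (6 + t)
T = 5F

-- As in all gadgets, `X` misses every colour: it is isolated in each two-coloured subgraph, so no
-- Kempe change affects it.
cherry : Gadget 3 2
cherry = record
  { edges = (X , Y) ∷ (X , C) ∷ []
  ; lists = allFin 2 ∷ (1F ∷ []) ∷ (0F ∷ []) ∷ []
  ; cert = colour (1F ∷ 0F ∷ [])
  ; valid = refl }

-- A Vizing fan centred at `Y`: the colour 1F of the edge to `W` is missing at `X`, and `X` and `W`
-- both miss 2F. If the swap at `Y` reaches neither `C` nor `W`, the edge to `W` moves to 2F and
-- gives up 1F to the edge `X Y`.
fan : Gadget 4 3
fan = record
  { edges = (X , Y) ∷ (X , C) ∷ (Y , W) ∷ []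
  ; lists = allFin 3 ∷ (0F ∷ 1F ∷ []) ∷ (0F ∷ []) ∷ (1F ∷ 2F ∷ []) ∷ []
  ; cert = kempe 2F 0F Y
      (colour (1F ∷ 0F ∷ 2F ∷ []))
      ( C ⇒ colour (1F ∷ 2F ∷ 2F ∷ [])
      ∣ W ⇒ colour (2F ∷ 0F ∷ 1F ∷ [])
      ∣ end )
  ; valid = refl }

-- The repeated colour is b here. Soundness needs distinct gadget colours to be distinct in the
-- graph, so each coincidence of colours requires a certificate of its own.
fan′ : Gadget 4 2
fan′ = record
  { edges = (X , Y) ∷ (X , C) ∷ (Y , W) ∷ []
  ; lists = allFin 2 ∷ (0F ∷ 1F ∷ []) ∷ (0F ∷ []) ∷ (1F ∷ 0F ∷ []) ∷ []
  ; cert = colour (1F ∷ 0F ∷ 0F ∷ [])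
  ; valid = refl }

kierstead : Gadget 5 5
kierstead = record
  { edges = (X , Y) ∷ (X , C) ∷ (Y , W) ∷ (W , U) ∷ []
  ; lists = allFin 5 ∷ (0F ∷ 1F ∷ []) ∷ (0F ∷ []) ∷ (1F ∷ 2F ∷ []) ∷ (2F ∷ 3F ∷ 4F ∷ []) ∷ []
  ; cert = kempe 3F 0F Y
      (colour (3F ∷ 0F ∷ 1F ∷ 2F ∷ []))
      ( C ⇒ kempe 3F 1F C
        (colour (3F ∷ 1F ∷ 1F ∷ 2F ∷ []))
        ( W ⇒ kempe 4F 1F Y
          (colour (4F ∷ 1F ∷ 3F ∷ 2F ∷ []))
          ( C ⇒ kempe 2F 4F Y
            (colour (2F ∷ 4F ∷ 3F ∷ 2F ∷ []))
            ( C ⇒ colour (3F ∷ 2F ∷ 2F ∷ 3F ∷ [])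
            ∣ W ⇒ colour (2F ∷ 4F ∷ 3F ∷ 4F ∷ [])
            ∣ end )
          ∣ U ⇒ colour (4F ∷ 1F ∷ 3F ∷ 2F ∷ [])
          ∣ end )
        ∣ U ⇒ colour (3F ∷ 1F ∷ 1F ∷ 2F ∷ [])
        ∣ end )
      ∣ U ⇒ colour (3F ∷ 0F ∷ 1F ∷ 2F ∷ [])
      ∣ end )
  ; valid = refl }

-- One of the two colours missing at `U` is the colour 1F of the edge `Y W`.
kierstead′ : Gadget 5 4
kierstead′ = record
  { edges = (X , Y) ∷ (X , C) ∷ (Y , W) ∷ (W , U) ∷ []
  ; lists = allFin 4 ∷ (0F ∷ 1F ∷ []) ∷ (0F ∷ []) ∷ (1F ∷ 2F ∷ []) ∷ (2F ∷ 1F ∷ 3F ∷ []) ∷ []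
  ; cert = kempe 3F 0F Y
      (colour (3F ∷ 0F ∷ 1F ∷ 2F ∷ []))
      ( C ⇒ kempe 2F 3F Y
        (colour (1F ∷ 3F ∷ 2F ∷ 1F ∷ []))
        ( C ⇒ colour (1F ∷ 2F ∷ 2F ∷ 1F ∷ [])
        ∣ W ⇒ colour (2F ∷ 3F ∷ 1F ∷ 3F ∷ [])
        ∣ end )
      ∣ U ⇒ colour (3F ∷ 0F ∷ 1F ∷ 2F ∷ [])
      ∣ end )
  ; valid = refl }

-- The 4-cycle X Y W C with the edge `W U` attached; 4F is the colour missing at both `X` and `U`.
kite : Gadget 5 5
kite = record
  { edges = (X , Y) ∷ (X , C) ∷ (Y , W) ∷ (C , W) ∷ (W , U) ∷ []
  ; lists = allFin 5 ∷ (0F ∷ 1F ∷ []) ∷ (0F ∷ 2F ∷ []) ∷ (1F ∷ 2F ∷ 3F ∷ []) ∷ (3F ∷ 4F ∷ []) ∷ []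
  ; cert = kempe 4F 0F Y
      (colour (4F ∷ 0F ∷ 1F ∷ 2F ∷ 3F ∷ []))
      ( C ⇒ kempe 4F 2F Y
        (colour (2F ∷ 4F ∷ 1F ∷ 2F ∷ 3F ∷ []))
        ( W ⇒ follow 3F 2F Y
          (flip 0 (colour (3F ∷ 2F ∷ 1F ∷ 4F ∷ 3F ∷ [])))
          ( C ⇒ flip 0 (colour (3F ∷ 4F ∷ 1F ∷ 3F ∷ 4F ∷ []))
          ∣ W ⇒ flip 0 (colour (3F ∷ 4F ∷ 1F ∷ 2F ∷ 4F ∷ []))
          ∣ U ⇒ follow 4F 1F Y
            (flip 0 (kempe 1F 2F Y
              (colour (4F ∷ 2F ∷ 1F ∷ 4F ∷ 3F ∷ []))
              ( C ⇒ colour (1F ∷ 4F ∷ 4F ∷ 1F ∷ 3F ∷ [])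
              ∣ W ⇒ colour (1F ∷ 4F ∷ 4F ∷ 2F ∷ 3F ∷ [])
              ∣ end )))
            -- The first flip is on the chain in 4F and 1F. The chain in 3F and 2F, followed earlier
            -- and kept because its colours are disjoint from these, then moves to position 0.
            ( C ⇒ flip 0 (flip 0 (colour (4F ∷ 2F ∷ 3F ∷ 1F ∷ 4F ∷ [])))
            ∣ U ⇒ flip 0 (flip 0 (colour (4F ∷ 2F ∷ 3F ∷ 4F ∷ 1F ∷ [])))
            ∣ end )
          ∣ end )
        ∣ U ⇒ colour (2F ∷ 4F ∷ 1F ∷ 2F ∷ 3F ∷ [])
        ∣ end )
      ∣ U ⇒ colour (4F ∷ 0F ∷ 1F ∷ 2F ∷ 3F ∷ [])
      ∣ end )
  ; valid = refl }

kite′ : Gadget 5 4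
kite′ = record
  { edges = (X , Y) ∷ (X , C) ∷ (Y , W) ∷ (C , W) ∷ (W , U) ∷ []
  ; lists = allFin 4 ∷ (0F ∷ 1F ∷ []) ∷ (0F ∷ 2F ∷ []) ∷ (1F ∷ 2F ∷ 3F ∷ []) ∷ (3F ∷ 0F ∷ []) ∷ []
  ; cert = kempe 0F 2F Y
      (colour (2F ∷ 0F ∷ 1F ∷ 2F ∷ 3F ∷ []))
      ( W ⇒ follow 3F 2F Y
        (flip 0 (colour (3F ∷ 2F ∷ 1F ∷ 0F ∷ 3F ∷ [])))
        ( C ⇒ flip 0 (colour (3F ∷ 0F ∷ 1F ∷ 3F ∷ 0F ∷ []))
        ∣ W ⇒ flip 0 (colour (3F ∷ 0F ∷ 1F ∷ 2F ∷ 0F ∷ []))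
        ∣ U ⇒ follow 0F 1F Y
          (flip 0 (kempe 1F 2F Y
            (colour (0F ∷ 2F ∷ 1F ∷ 0F ∷ 3F ∷ []))
            ( C ⇒ colour (0F ∷ 1F ∷ 1F ∷ 0F ∷ 3F ∷ [])
            ∣ W ⇒ colour (1F ∷ 0F ∷ 0F ∷ 2F ∷ 3F ∷ [])
            ∣ end )))
          ( C ⇒ flip 0 (flip 0 (colour (0F ∷ 2F ∷ 3F ∷ 1F ∷ 0F ∷ [])))
          ∣ U ⇒ flip 0 (flip 0 (colour (0F ∷ 2F ∷ 3F ∷ 0F ∷ 1F ∷ [])))
          ∣ end )
        ∣ end )
      ∣ U ⇒ colour (2F ∷ 0F ∷ 1F ∷ 2F ∷ 3F ∷ [])
      ∣ end )
  ; valid = refl }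

-- The tail `U T` has colour 4F, and 5F and 6F are missing at its far end. No colour besides 3F and
-- 4F, freed by erasing edges, is assumed missing at `U`.
tailedKite : Gadget 6 7
tailedKite = record
  { edges = (X , Y) ∷ (X , C) ∷ (Y , W) ∷ (C , W) ∷ (W , U) ∷ (U , T) ∷ []
  ; lists = allFin 7 ∷ (0F ∷ 1F ∷ []) ∷ (0F ∷ 2F ∷ []) ∷ (1F ∷ 2F ∷ 3F ∷ []) ∷ (3F ∷ 4F ∷ []) ∷ (4F ∷ 5F ∷ 6F ∷ []) ∷ []
  ; cert = kempe 5F 0F Y
      (colour (5F ∷ 0F ∷ 1F ∷ 2F ∷ 3F ∷ 4F ∷ []))
      ( C ⇒ kempe 5F 1F C
        (colour (5F ∷ 1F ∷ 1F ∷ 2F ∷ 3F ∷ 4F ∷ []))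
        ( W ⇒ kempe 6F 1F Y
          (colour (6F ∷ 1F ∷ 5F ∷ 2F ∷ 3F ∷ 4F ∷ []))
          ( C ⇒ kempe 4F 6F Y
            (colour (4F ∷ 6F ∷ 5F ∷ 2F ∷ 3F ∷ 4F ∷ []))
            ( C ⇒ kempe 4F 5F C
              (colour (4F ∷ 5F ∷ 5F ∷ 2F ∷ 3F ∷ 4F ∷ []))
              ( W ⇒ kempe 5F 2F Y
                (colour (2F ∷ 5F ∷ 4F ∷ 2F ∷ 3F ∷ 4F ∷ []))
                ( W ⇒ kempe 6F 2F Y
                  (colour (6F ∷ 2F ∷ 4F ∷ 5F ∷ 3F ∷ 4F ∷ []))
                  ( C ⇒ follow 6F 3F C
                    (flip 0 (colour (6F ∷ 3F ∷ 4F ∷ 5F ∷ 3F ∷ 4F ∷ [])))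
                    ( Y ⇒ flip 0 (kempe 5F 3F Y
                      (colour (5F ∷ 3F ∷ 4F ∷ 5F ∷ 3F ∷ 4F ∷ []))
                      ( U ⇒ colour (4F ∷ 5F ∷ 5F ∷ 3F ∷ 4F ∷ 5F ∷ [])
                      ∣ T ⇒ colour (4F ∷ 5F ∷ 5F ∷ 3F ∷ 4F ∷ 3F ∷ [])
                      ∣ end ))
                    ∣ W ⇒ flip 0 (kempe 5F 3F W
                      (kempe 6F 3F C
                        (colour (6F ∷ 5F ∷ 4F ∷ 6F ∷ 3F ∷ 4F ∷ []))
                        ( Y ⇒ colour (3F ∷ 5F ∷ 4F ∷ 6F ∷ 3F ∷ 4F ∷ [])
                        ∣ U ⇒ kempe 5F 3F C
                          (colour (4F ∷ 6F ∷ 6F ∷ 3F ∷ 4F ∷ 6F ∷ []))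
                          ( W ⇒ kempe 6F 5F Y
                            (colour (4F ∷ 3F ∷ 5F ∷ 6F ∷ 4F ∷ 6F ∷ []))
                            ( C ⇒ colour (5F ∷ 3F ∷ 4F ∷ 5F ∷ 6F ∷ 4F ∷ [])
                            ∣ U ⇒ colour (4F ∷ 3F ∷ 5F ∷ 6F ∷ 4F ∷ 5F ∷ [])
                            ∣ end )
                          ∣ T ⇒ colour (4F ∷ 6F ∷ 6F ∷ 3F ∷ 4F ∷ 6F ∷ [])
                          ∣ end )
                        ∣ T ⇒ colour (6F ∷ 5F ∷ 4F ∷ 6F ∷ 3F ∷ 4F ∷ [])
                        ∣ end ))
                      ( U ⇒ colour (4F ∷ 5F ∷ 6F ∷ 3F ∷ 4F ∷ 5F ∷ [])
                      ∣ T ⇒ colour (4F ∷ 5F ∷ 6F ∷ 3F ∷ 4F ∷ 3F ∷ [])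
                      ∣ end ))
                    ∣ U ⇒ follow 4F 5F Y
                      (flip 0 (flip 0 (colour (6F ∷ 5F ∷ 5F ∷ 3F ∷ 4F ∷ 6F ∷ []))))
                      ( C ⇒ flip 0 (flip 0 (colour (6F ∷ 4F ∷ 5F ∷ 3F ∷ 4F ∷ 6F ∷ [])))
                      ∣ U ⇒ flip 0 (kempe 4F 6F Y
                        (colour (5F ∷ 6F ∷ 4F ∷ 5F ∷ 3F ∷ 5F ∷ []))
                        ( C ⇒ colour (4F ∷ 5F ∷ 5F ∷ 4F ∷ 3F ∷ 5F ∷ [])
                        ∣ W ⇒ colour (4F ∷ 5F ∷ 5F ∷ 6F ∷ 3F ∷ 5F ∷ [])
                        ∣ end ))
                      ∣ end )
                    ∣ T ⇒ flip 0 (colour (6F ∷ 3F ∷ 4F ∷ 5F ∷ 3F ∷ 4F ∷ []))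
                    ∣ end )
                  ∣ T ⇒ colour (6F ∷ 2F ∷ 4F ∷ 5F ∷ 3F ∷ 4F ∷ [])
                  ∣ end )
                ∣ T ⇒ colour (2F ∷ 5F ∷ 4F ∷ 2F ∷ 3F ∷ 4F ∷ [])
                ∣ end )
              ∣ U ⇒ colour (4F ∷ 5F ∷ 5F ∷ 2F ∷ 3F ∷ 5F ∷ [])
              ∣ end )
            ∣ U ⇒ colour (4F ∷ 6F ∷ 5F ∷ 2F ∷ 3F ∷ 6F ∷ [])
            ∣ end )
          ∣ T ⇒ colour (6F ∷ 1F ∷ 5F ∷ 2F ∷ 3F ∷ 4F ∷ [])
          ∣ end )
        ∣ T ⇒ colour (5F ∷ 1F ∷ 1F ∷ 2F ∷ 3F ∷ 4F ∷ [])
        ∣ end )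
      ∣ T ⇒ colour (5F ∷ 0F ∷ 1F ∷ 2F ∷ 3F ∷ 4F ∷ [])
      ∣ end )
  ; valid = refl }

any-only : (P : Fin m → Set) (is : List (Fin m)) {c : Fin m} → All P is → any (only c) is ≡ true → P c
any-only P (i ∷ is) {c} (p ∷ ps) e with only c i in o
... | true = subst P (only-≡ o) p
... | false = any-only P is ps e

-- Applying gadgets to a colouring

module Reduction (E : Fin n → Fin n → Bool) (¬colourable : ¬ Colourable E k) where

  Touched : Vec (Fin n) t → List (Fin t × Fin t) → Fin n → Fin n → Set
  Touched vs es u v = Any (λ (a , b) → SameEdge (lookup vs a) (lookup vs b) u v) es

  data Free (f : Colouring n k) (vs : Vec (Fin n) t) (es : List (Fin t × Fin t)) (u : Fin n) (i : Fin k) : Set where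
    kept : Missing f u i → Free f vs es u i
    gone : ∀ {v} → Touched vs es u v → f u v ≡ just i → Free f vs es u i

  -- Erasing the gadget edges makes the lists true, and the certificate then colours all of `E`.
  -- Edges uncoloured from the start must belong to the gadget, since nothing else receives a
  -- colour.
  reduce : (g : Gadget t m) {f : Colouring n k} → Proper f →
           (vs : Vec (Fin n) t) → Unique vs → (cs : Vec (Fin k) m) → Unique cs →
           (∀ {u v} → E u v ≡ true → f u v ≡ nothing → Touched vs (edges g) u v) →
           (∀ a → All (λ c → Free f vs (edges g) (lookup vs a) (lookup cs c)) (lookup (lists g) a)) →
           ⊥
  reduce g {f} pf vs vs-unique cs cs-unique cover free =
    ¬colourable (sound (edges g) (cert g) (without-proper f D? pf (Any.map sameEdge-flip)) real [] cov (valid g))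
    where
    open Soundness E (lookup vs) (lookup-injective vs-unique _ _) (lookup cs) (lookup-injective cs-unique _ _)
    D? : ∀ u v → Dec (Touched vs (edges g) u v)
    D? u v = Any.any? (λ (a , b) → sameEdge? (lookup vs a) (lookup vs b) u v) (edges g)
    real : Realises (without f D?) (toLists (lists g))
    real v c = any-only _ (lookup (lists g) v) (All.map missing (free v))
      where
      missing : ∀ {u i} → Free f vs (edges g) u i → Missing (without f D?) u i
      missing (kept m) = without-missing f D? m
      missing (gone d e) = removed-missing f D? pf d e
    cov : Covers (without f D?) (edges g)
    cov u v e e′ = [ id , cover e ]′ (without-nothing f D? e′)

  -- Removing xc as well makes y and c interchangeable.
  record Base (h : Colouring n k) (x y c : Fin n) (b : Fin k) : Set where
    field
      proper   : Proper h
      gap      : ∀ {u v} → E u v ≡ true → h u v ≡ nothing → SameEdge x y u v ⊎ SameEdge x c u v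
      loopless : ∀ {u v i} → h u v ≡ just i → u ≢ v
      x≢y      : x ≢ y
      x≢c      : x ≢ c
      y≢c      : y ≢ c
      xb       : Missing h x b
      yb       : Missing h y b
      cb       : Missing h c b

  exchange : ∀ {h x y c b} → Base h x y c b → Base h x c y b
  exchange base = record
    { proper = proper ; gap = λ e e′ → Sum.swap (gap e e′) ; loopless = loopless
    ; x≢y = x≢c ; x≢c = x≢y ; y≢c = ≢-sym y≢c ; xb = xb ; yb = cb ; cb = yb }
    where open Base base

  pattern fwd = here (inj₁ (refl , refl))
  pattern bwd = here (inj₂ (refl , refl))

  module Configurations {h x y c b} (base : Base h x y c b) where
    open Base base public

    rev : ∀ {u v i} → h u v ≡ just i → h v u ≡ just i
    rev {u} {v} e = trans (symmetric proper v u) e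

    apart : ∀ {u v w i} → h u w ≡ just i → Missing h v i → u ≢ v
    apart e m refl = m _ e

    apart-colour : ∀ {u w i j} → h u w ≡ just i → Missing h u j → i ≢ j
    apart-colour e m refl = m _ e

    differ : ∀ {u v w i j} → h u v ≡ just i → h u w ≡ just j → v ≢ w → i ≢ j
    differ e e′ v≢w refl = v≢w (unique proper e e′)

    Large : Fin k → Set
    Large i = i ≢ b × Missing h x i

    -- Otherwise xy takes `i` and xc takes `b`. This fixes the number of neighbours of y along large
    -- colours.
    y-full : ∀ {i} → Large i → ¬ Missing h y i
    y-full {i} (i≢b , xi) yi = reduce cherry proper
      (x ∷ y ∷ c ∷ []) ((x≢y ∷ᵃ x≢c ∷ᵃ []ᵃ) ∷ᵘ (y≢c ∷ᵃ []ᵃ) ∷ᵘ []ᵃ ∷ᵘ []ᵘ)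
      (b ∷ i ∷ []) ((≢-sym i≢b ∷ᵃ []ᵃ) ∷ᵘ []ᵃ ∷ᵘ []ᵘ)
      (λ e e′ → [ here , there ∘ here ]′ (gap e e′))
      λ { 0F → kept xb ∷ kept xi ∷ []
        ; 1F → kept yi ∷ []
        ; 2F → kept cb ∷ [] }

    fan-missing : ∀ {u α i} → h y u ≡ just α → Missing h x α → u ≢ c → Missing h x i → ¬ Missing h u i
    fan-missing {u} {α} {i} yu xα u≢c xi ui = case i ≟ b of λ where
        (no i≢b) → reduce fan proper vs vs-unique
          (b ∷ α ∷ i ∷ [])
          ((≢-sym α≢b ∷ᵃ ≢-sym i≢b ∷ᵃ []ᵃ) ∷ᵘ (apart-colour (rev yu) ui ∷ᵃ []ᵃ) ∷ᵘ []ᵃ ∷ᵘ []ᵘ)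
          (λ e e′ → [ here , there ∘ here ]′ (gap e e′))
          λ { 0F → kept xb ∷ kept xα ∷ kept xi ∷ []
            ; 1F → kept yb ∷ gone (there (there fwd)) yu ∷ []
            ; 2F → kept cb ∷ []
            ; 3F → gone (there (there bwd)) (rev yu) ∷ kept ui ∷ [] }
        (yes refl) → reduce fan′ proper vs vs-unique
          (b ∷ α ∷ []) ((≢-sym α≢b ∷ᵃ []ᵃ) ∷ᵘ []ᵃ ∷ᵘ []ᵘ)
          (λ e e′ → [ here , there ∘ here ]′ (gap e e′))
          λ { 0F → kept xb ∷ kept xα ∷ []
            ; 1F → kept yb ∷ gone (there (there fwd)) yu ∷ []
            ; 2F → kept cb ∷ []
            ; 3F → gone (there (there bwd)) (rev yu) ∷ kept ui ∷ [] }
      where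
      α≢b = apart-colour yu yb
      vs = x ∷ y ∷ c ∷ u ∷ []
      vs-unique : Unique vs
      vs-unique = (x≢y ∷ᵃ x≢c ∷ᵃ ≢-sym (apart (rev yu) xα) ∷ᵃ []ᵃ) ∷ᵘ (y≢c ∷ᵃ loopless yu ∷ᵃ []ᵃ) ∷ᵘ
                  (≢-sym u≢c ∷ᵃ []ᵃ) ∷ᵘ []ᵃ ∷ᵘ []ᵘ

    kierstead-missing : ∀ {w u α γ i j} → h y w ≡ just α → h w u ≡ just γ → Missing h x α → Large γ →
                        w ≢ c → u ≢ y → u ≢ c → i ≢ j → Large i → Large j →
                        Missing h u i → ¬ Missing h u j
    kierstead-missing {w} {u} {α} {γ} {i} {j} yw wu xα (γ≢b , xγ) w≢c u≢y u≢c i≢j (i≢b , xi) (j≢b , xj) ui uj =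
      case (i ≟ α) , (j ≟ α) of λ where
        (yes refl , _) → coincide j≢b (≢-sym i≢j) xj ui uj
        (no _ , yes refl) → coincide i≢b i≢j xi uj ui
        (no i≢α , no j≢α) → reduce kierstead proper vs vs-unique
          (b ∷ α ∷ γ ∷ i ∷ j ∷ [])
          ((≢-sym α≢b ∷ᵃ ≢-sym γ≢b ∷ᵃ ≢-sym i≢b ∷ᵃ ≢-sym j≢b ∷ᵃ []ᵃ) ∷ᵘ
           (α≢γ ∷ᵃ ≢-sym i≢α ∷ᵃ ≢-sym j≢α ∷ᵃ []ᵃ) ∷ᵘ
           (apart-colour (rev wu) ui ∷ᵃ apart-colour (rev wu) uj ∷ᵃ []ᵃ) ∷ᵘ (i≢j ∷ᵃ []ᵃ) ∷ᵘ []ᵃ ∷ᵘ []ᵘ)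
          (λ e e′ → [ here , there ∘ here ]′ (gap e e′))
          λ { 0F → kept xb ∷ kept xα ∷ kept xγ ∷ kept xi ∷ kept xj ∷ []
            ; 1F → kept yb ∷ gone (there (there fwd)) yw ∷ []
            ; 2F → kept cb ∷ []
            ; 3F → gone (there (there bwd)) (rev yw) ∷ gone (there (there (there fwd))) wu ∷ []
            ; 4F → gone (there (there (there bwd))) (rev wu) ∷ kept ui ∷ kept uj ∷ [] }
      where
      α≢b = apart-colour yw yb
      α≢γ = differ (rev yw) wu (≢-sym u≢y)
      vs = x ∷ y ∷ c ∷ w ∷ u ∷ []
      vs-unique : Unique vs
      vs-unique = (x≢y ∷ᵃ x≢c ∷ᵃ ≢-sym (apart (rev yw) xα) ∷ᵃ ≢-sym (apart (rev wu) xγ) ∷ᵃ []ᵃ) ∷ᵘ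
                  (y≢c ∷ᵃ loopless yw ∷ᵃ ≢-sym u≢y ∷ᵃ []ᵃ) ∷ᵘ
                  (≢-sym w≢c ∷ᵃ ≢-sym u≢c ∷ᵃ []ᵃ) ∷ᵘ (loopless wu ∷ᵃ []ᵃ) ∷ᵘ []ᵃ ∷ᵘ []ᵘ
      -- The two colours missing at `u` differ, so only one of them can be the colour of `yw`; `l`
      -- is the other.
      coincide : ∀ {l} → l ≢ b → l ≢ α → Missing h x l → Missing h u α → Missing h u l → ⊥
      coincide {l} l≢b l≢α xl uα ul = reduce kierstead′ proper vs vs-unique
          (b ∷ α ∷ γ ∷ l ∷ [])
          ((≢-sym α≢b ∷ᵃ ≢-sym γ≢b ∷ᵃ ≢-sym l≢b ∷ᵃ []ᵃ) ∷ᵘ (α≢γ ∷ᵃ ≢-sym l≢α ∷ᵃ []ᵃ) ∷ᵘ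
           (apart-colour (rev wu) ul ∷ᵃ []ᵃ) ∷ᵘ []ᵃ ∷ᵘ []ᵘ)
          (λ e e′ → [ here , there ∘ here ]′ (gap e e′))
          λ { 0F → kept xb ∷ kept xα ∷ kept xγ ∷ kept xl ∷ []
            ; 1F → kept yb ∷ gone (there (there fwd)) yw ∷ []
            ; 2F → kept cb ∷ []
            ; 3F → gone (there (there bwd)) (rev yw) ∷ gone (there (there (there fwd))) wu ∷ []
            ; 4F → gone (there (there (there bwd))) (rev wu) ∷ kept uα ∷ kept ul ∷ [] }

    module Kite {w u α β γ} (yw : h y w ≡ just α) (cw : h c w ≡ just β) (wu : h w u ≡ just γ)
                (xα : Missing h x α) (xβ : Missing h x β) (large-γ : Large γ)
                (u≢y : u ≢ y) (u≢c : u ≢ c) where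
      γ≢b = proj₁ large-γ
      xγ = proj₂ large-γ
      α≢b = apart-colour yw yb
      β≢b = apart-colour cw cb
      α≢β = differ (rev yw) (rev cw) y≢c
      α≢γ = differ (rev yw) wu (≢-sym u≢y)
      β≢γ = differ (rev cw) wu (≢-sym u≢c)
      x≢w = ≢-sym (apart (rev yw) xα)
      x≢u = ≢-sym (apart (rev wu) xγ)

      kite-missing : ∀ {i} → i ≢ α → i ≢ β → Missing h x i → ¬ Missing h u i
      kite-missing {i} i≢α i≢β xi ui = case i ≟ b of λ where
          (no i≢b) → reduce kite proper vs vs-unique
            (b ∷ α ∷ β ∷ γ ∷ i ∷ [])
            ((≢-sym α≢b ∷ᵃ ≢-sym β≢b ∷ᵃ ≢-sym γ≢b ∷ᵃ ≢-sym i≢b ∷ᵃ []ᵃ) ∷ᵘ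
             (α≢β ∷ᵃ α≢γ ∷ᵃ ≢-sym i≢α ∷ᵃ []ᵃ) ∷ᵘ (β≢γ ∷ᵃ ≢-sym i≢β ∷ᵃ []ᵃ) ∷ᵘ
             (apart-colour (rev wu) ui ∷ᵃ []ᵃ) ∷ᵘ []ᵃ ∷ᵘ []ᵘ)
            (λ e e′ → [ here , there ∘ here ]′ (gap e e′))
            λ { 0F → kept xb ∷ kept xα ∷ kept xβ ∷ kept xγ ∷ kept xi ∷ []
              ; 1F → kept yb ∷ gone (there (there fwd)) yw ∷ []
              ; 2F → kept cb ∷ gone (there (there (there fwd))) cw ∷ []
              ; 3F → gone (there (there bwd)) (rev yw) ∷ gone (there (there (there bwd))) (rev cw) ∷
                     gone (there (there (there (there fwd)))) wu ∷ []
              ; 4F → gone (there (there (there (there bwd)))) (rev wu) ∷ kept ui ∷ [] }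
          (yes refl) → reduce kite′ proper vs vs-unique
            (b ∷ α ∷ β ∷ γ ∷ [])
            ((≢-sym α≢b ∷ᵃ ≢-sym β≢b ∷ᵃ ≢-sym γ≢b ∷ᵃ []ᵃ) ∷ᵘ
             (α≢β ∷ᵃ α≢γ ∷ᵃ []ᵃ) ∷ᵘ (β≢γ ∷ᵃ []ᵃ) ∷ᵘ []ᵃ ∷ᵘ []ᵘ)
            (λ e e′ → [ here , there ∘ here ]′ (gap e e′))
            λ { 0F → kept xb ∷ kept xα ∷ kept xβ ∷ kept xγ ∷ []
              ; 1F → kept yb ∷ gone (there (there fwd)) yw ∷ []
              ; 2F → kept cb ∷ gone (there (there (there fwd))) cw ∷ []
              ; 3F → gone (there (there bwd)) (rev yw) ∷ gone (there (there (there bwd))) (rev cw) ∷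
                     gone (there (there (there (there fwd)))) wu ∷ []
              ; 4F → gone (there (there (there (there bwd)))) (rev wu) ∷ kept ui ∷ [] }
        where
        vs = x ∷ y ∷ c ∷ w ∷ u ∷ []
        vs-unique : Unique vs
        vs-unique = (x≢y ∷ᵃ x≢c ∷ᵃ x≢w ∷ᵃ x≢u ∷ᵃ []ᵃ) ∷ᵘ (y≢c ∷ᵃ loopless yw ∷ᵃ ≢-sym u≢y ∷ᵃ []ᵃ) ∷ᵘ
                    (loopless cw ∷ᵃ ≢-sym u≢c ∷ᵃ []ᵃ) ∷ᵘ (loopless wu ∷ᵃ []ᵃ) ∷ᵘ []ᵃ ∷ᵘ []ᵘ

      tailed-kite : ∀ {v μ p q} → h u v ≡ just μ → v ≢ y → v ≢ c → v ≢ w → Large μ → μ ≢ α → μ ≢ β →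
                    p ≢ q → p ≢ b → q ≢ b → All (p ≢_) (α ∷ β ∷ γ ∷ []) → All (q ≢_) (α ∷ β ∷ γ ∷ []) →
                    Missing h x p → Missing h x q → Missing h v p → ¬ Missing h v q
      tailed-kite {v} {μ} {p} {q} uv v≢y v≢c v≢w (μ≢b , xμ) μ≢α μ≢β p≢q p≢b q≢b
        (p≢α ∷ p≢β ∷ p≢γ ∷ []) (q≢α ∷ q≢β ∷ q≢γ ∷ []) xp xq vp vq =
        reduce tailedKite proper
          (x ∷ y ∷ c ∷ w ∷ u ∷ v ∷ [])
          ((x≢y ∷ᵃ x≢c ∷ᵃ x≢w ∷ᵃ x≢u ∷ᵃ ≢-sym (apart (rev uv) xμ) ∷ᵃ []ᵃ) ∷ᵘ
           (y≢c ∷ᵃ loopless yw ∷ᵃ ≢-sym u≢y ∷ᵃ ≢-sym v≢y ∷ᵃ []ᵃ) ∷ᵘ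
           (loopless cw ∷ᵃ ≢-sym u≢c ∷ᵃ ≢-sym v≢c ∷ᵃ []ᵃ) ∷ᵘ
           (loopless wu ∷ᵃ ≢-sym v≢w ∷ᵃ []ᵃ) ∷ᵘ (loopless uv ∷ᵃ []ᵃ) ∷ᵘ []ᵃ ∷ᵘ []ᵘ)
          (b ∷ α ∷ β ∷ γ ∷ μ ∷ p ∷ q ∷ [])
          ((≢-sym α≢b ∷ᵃ ≢-sym β≢b ∷ᵃ ≢-sym γ≢b ∷ᵃ ≢-sym μ≢b ∷ᵃ ≢-sym p≢b ∷ᵃ ≢-sym q≢b ∷ᵃ []ᵃ) ∷ᵘ
           (α≢β ∷ᵃ α≢γ ∷ᵃ ≢-sym μ≢α ∷ᵃ ≢-sym p≢α ∷ᵃ ≢-sym q≢α ∷ᵃ []ᵃ) ∷ᵘ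
           (β≢γ ∷ᵃ ≢-sym μ≢β ∷ᵃ ≢-sym p≢β ∷ᵃ ≢-sym q≢β ∷ᵃ []ᵃ) ∷ᵘ
           (differ (rev wu) uv (≢-sym v≢w) ∷ᵃ ≢-sym p≢γ ∷ᵃ ≢-sym q≢γ ∷ᵃ []ᵃ) ∷ᵘ
           (apart-colour (rev uv) vp ∷ᵃ apart-colour (rev uv) vq ∷ᵃ []ᵃ) ∷ᵘ (p≢q ∷ᵃ []ᵃ) ∷ᵘ []ᵃ ∷ᵘ []ᵘ)
          (λ e e′ → [ here , there ∘ here ]′ (gap e e′))
          λ { 0F → kept xb ∷ kept xα ∷ kept xβ ∷ kept xγ ∷ kept xμ ∷ kept xp ∷ kept xq ∷ []
            ; 1F → kept yb ∷ gone (there (there fwd)) yw ∷ []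
            ; 2F → kept cb ∷ gone (there (there (there fwd))) cw ∷ []
            ; 3F → gone (there (there bwd)) (rev yw) ∷ gone (there (there (there bwd))) (rev cw) ∷
                   gone (there (there (there (there fwd)))) wu ∷ []
            ; 4F → gone (there (there (there (there bwd)))) (rev wu) ∷
                   gone (there (there (there (there (there fwd))))) uv ∷ []
            ; 5F → gone (there (there (there (there (there bwd))))) (rev uv) ∷ kept vp ∷ kept vq ∷ [] }

-- Counting

⟦_⟧ : Bool → ℕ
⟦ true ⟧ = 1
⟦ false ⟧ = 0

count : (Fin n → Bool) → ℕ
count P = sum λ i → ⟦ P i ⟧

⟦⟧≤1 : ∀ a → ⟦ a ⟧ ≤ 1
⟦⟧≤1 true = ≤-refl
⟦⟧≤1 false = z≤n

sum-mono : {f g : Fin n → ℕ} → (∀ i → f i ≤ g i) → sum f ≤ sum g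
sum-mono {zero} le = z≤n
sum-mono {suc n} le = +-mono-≤ (le zero) (sum-mono (le ∘ suc))

sum-mono-< : {f g : Fin n → ℕ} → (∀ i → f i ≤ g i) → ∀ z → f z < g z → sum f < sum g
sum-mono-< le zero lt = +-mono-<-≤ lt (sum-mono (le ∘ suc))
sum-mono-< le (suc z) lt = +-mono-≤-< (le zero) (sum-mono-< (le ∘ suc) z lt)

sum-zero : {f : Fin n → ℕ} → (∀ i → f i ≡ 0) → sum f ≡ 0
sum-zero {zero} e = refl
sum-zero {suc n} e = cong₂ _+_ (e zero) (sum-zero (e ∘ suc))

sum-const : ∀ n c → sum {n} (λ _ → c) ≡ n * c
sum-const zero c = refl
sum-const (suc n) c = cong (c +_) (sum-const n c)

sum-concentrated : {f : Fin n → ℕ} → ∀ z → (∀ i → i ≢ z → f i ≡ 0) → sum f ≡ f z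
sum-concentrated {suc n} {f} zero e = trans (cong (f zero +_) (sum-zero λ i → e (suc i) λ ())) (+-identityʳ _)
sum-concentrated {suc n} (suc z) e =
  cong₂ _+_ (e zero λ ()) (sum-concentrated z λ i i≢z → e (suc i) λ { refl → i≢z refl })

sum-+ : {f g : Fin n → ℕ} {a b : ℕ} → sum f ≡ a → sum g ≡ b → sum (λ i → f i + g i) ≡ a + b
sum-+ {f = f} {g} e e′ = trans (∑-distrib-+ f g) (cong₂ _+_ e e′)

sum-ones : ∀ n → sum {n} (λ _ → 1) ≡ n
sum-ones n = trans (sum-const n 1) (*-identityʳ n)

count-only : (z : Fin n) → count (only z) ≡ 1
count-only z = trans (sum-concentrated z λ i i≢z → cong ⟦_⟧ (only-≢ i≢z)) (cong ⟦_⟧ (only-refl z))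

count-complement : (P : Fin n → Bool) → count P + count (not ∘ P) ≡ n
count-complement {n} P = begin
  count P + count (not ∘ P)                    ≡⟨ ∑-distrib-+ (λ i → ⟦ P i ⟧) (λ i → ⟦ not (P i) ⟧) ⟨
  sum (λ i → ⟦ P i ⟧ + ⟦ not (P i) ⟧)          ≡⟨ sum-cong-≗ (λ i → one (P i)) ⟩
  sum {n} (λ _ → 1)                            ≡⟨ sum-const n 1 ⟩
  n * 1                                        ≡⟨ *-identityʳ n ⟩
  n                                            ∎
  where
  open ≡-Reasoning
  one : ∀ a → ⟦ a ⟧ + ⟦ not a ⟧ ≡ 1
  one true = refl
  one false = refl

count-covered : (xs : List (Fin n)) (P : Fin n → Bool) → (∀ i → P i ≡ true → Any (i ≡_) xs) → count P ≤ length xs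
count-covered [] P cov = ≤-reflexive (sum-zero λ i → zero-if (P i) λ e → case cov i e of λ ())
  where
  zero-if : ∀ a → ¬ (a ≡ true) → ⟦ a ⟧ ≡ 0
  zero-if true na = ⊥-elim (na refl)
  zero-if false _ = refl
count-covered (x ∷ xs) P cov = begin
  count P                                                ≤⟨ sum-mono (λ i → split (P i) (only x i)) ⟩
  sum (λ i → ⟦ only x i ⟧ + ⟦ P i ∧ not (only x i) ⟧)    ≡⟨ ∑-distrib-+ (λ i → ⟦ only x i ⟧) _ ⟩
  count (only x) + count (λ i → P i ∧ not (only x i))    ≡⟨ cong (_+ count (λ i → P i ∧ not (only x i))) (count-only x) ⟩
  1 + count (λ i → P i ∧ not (only x i))                 ≤⟨ s≤s (count-covered xs _ rest) ⟩
  1 + length xs                                          ∎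
  where
  open ≤-Reasoning
  split : ∀ a b → ⟦ a ⟧ ≤ ⟦ b ⟧ + ⟦ a ∧ not b ⟧
  split true true = s≤s z≤n
  split true false = s≤s z≤n
  split false b = z≤n
  rest : ∀ i → P i ∧ not (only x i) ≡ true → Any (i ≡_) xs
  rest i e with Pi , i≢x ← ∧-split {P i} e = case cov i Pi of λ where
    (here i≡x) → ⊥-elim (only-false {z = x} (not-true i≢x) i≡x)
    (there r) → r

pick : (P : Fin n → Bool) (xs : List (Fin n)) → length xs < count P →
       ∃ λ i → P i ≡ true × All (i ≢_) xs
pick P xs lt with any? (λ i → P i ≟ᵇ true ×-dec All.all? (λ x → ¬? (i ≟ x)) xs)
... | yes found = found
... | no none = contradiction (count-covered xs P λ i Pi → covered i Pi) (<⇒≱ lt)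
  where
  covered : ∀ i → P i ≡ true → Any (i ≡_) xs
  covered i Pi with Any.any? (i ≟_) xs
  ... | yes r = r
  ... | no ¬r = ⊥-elim (none (i , Pi , All.tabulate λ { x∈ refl → ¬r x∈ }))

count≤1 : (P : Fin n → Bool) → (∀ {i j} → P i ≡ true → P j ≡ true → i ≡ j) → count P ≤ 1
count≤1 P unique with any? (λ i → P i ≟ᵇ true)
... | yes (z , Pz) = count-covered (z ∷ []) P λ i Pi → here (unique Pi Pz)
... | no none = ≤-trans (count-covered [] P λ i Pi → ⊥-elim (none (i , Pi))) z≤n

hasColour : Maybe (Fin k) → Fin k → Bool
hasColour m i = does (maybe-≡-dec _≟_ m (just i))

hasColour-true : ∀ {m : Maybe (Fin k)} {i} → m ≡ just i → hasColour m i ≡ true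
hasColour-true {m = m} {i} = dec-true (maybe-≡-dec _≟_ m (just i))

hasColour-false : ∀ {m : Maybe (Fin k)} {i} → m ≢ just i → hasColour m i ≡ false
hasColour-false {m = m} {i} = dec-false (maybe-≡-dec _≟_ m (just i))

hasColour-just : ∀ {m : Maybe (Fin k)} {i} → hasColour m i ≡ true → m ≡ just i
hasColour-just {m = m} {i} e with maybe-≡-dec _≟_ m (just i)
... | yes p = p

colourIn : (Fin k → Bool) → Maybe (Fin k) → Bool
colourIn A = maybe′ A false

present : Colouring n k → Fin n → Fin k → Bool
present f u i = does (present? f u i)

∑-hasColour : (A : Fin k → Bool) (m : Maybe (Fin k)) →
              sum (λ i → ⟦ A i ∧ hasColour m i ⟧) ≡ ⟦ colourIn A m ⟧
∑-hasColour A nothing = sum-zero λ i → cong ⟦_⟧ (∧-zeroʳ (A i))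
∑-hasColour A (just j) = trans
  (sum-concentrated j λ i i≢j → trans
    (cong (λ a → ⟦ A i ∧ a ⟧) (hasColour-false {m = just j} λ e → i≢j (sym (just-injective e))))
    (cong ⟦_⟧ (∧-zeroʳ (A i))))
  (trans (cong (λ a → ⟦ A j ∧ a ⟧) (hasColour-true {m = just j} refl)) (cong ⟦_⟧ (∧-true (A j))))
  where
  ∧-true : ∀ a → a ∧ true ≡ a
  ∧-true true = refl
  ∧-true false = refl

module _ {f : Colouring n k} (pf : Proper f) (A : Fin k → Bool) (u : Fin n) where

  ∑-colour-class : ∀ i → sum (λ w → ⟦ A i ∧ hasColour (f u w) i ⟧) ≡ ⟦ A i ∧ present f u i ⟧
  ∑-colour-class i with present? f u i
  ... | yes (v , e) = trans
    (sum-concentrated v λ w w≢v → trans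
      (cong (λ a → ⟦ A i ∧ a ⟧) (hasColour-false λ e′ → w≢v (unique pf e′ e)))
      (cong ⟦_⟧ (∧-zeroʳ (A i))))
    (cong (λ a → ⟦ A i ∧ a ⟧) (hasColour-true e))
  ... | no ¬p = trans
    (sum-zero λ w → trans (cong (λ a → ⟦ A i ∧ a ⟧) (hasColour-false λ e → ¬p (w , e))) (cong ⟦_⟧ (∧-zeroʳ (A i))))
    (sym (cong ⟦_⟧ (∧-zeroʳ (A i))))

  -- Double counting of pairs of a neighbour and a colour: an edge has one colour, and by properness
  -- a colour leads to one neighbour.
  count-neighbours : count (λ w → colourIn A (f u w)) ≡ count (λ i → A i ∧ present f u i)
  count-neighbours = begin
    sum (λ w → ⟦ colourIn A (f u w) ⟧)                         ≡⟨ sum-cong-≗ (λ w → sym (∑-hasColour A (f u w))) ⟩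
    sum (λ w → sum (λ i → ⟦ A i ∧ hasColour (f u w) i ⟧))      ≡⟨ ∑-comm (λ w i → ⟦ A i ∧ hasColour (f u w) i ⟧) ⟩
    sum (λ i → sum (λ w → ⟦ A i ∧ hasColour (f u w) i ⟧))      ≡⟨ sum-cong-≗ ∑-colour-class ⟩
    count (λ i → A i ∧ present f u i)                          ∎
    where open ≡-Reasoning

<ᵇ-true : ∀ {a b} → a < b → (a <ᵇ b) ≡ true
<ᵇ-true {a} {b} = dec-true (a <? b)

<ᵇ-false : ∀ {a b} → ¬ a < b → (a <ᵇ b) ≡ false
<ᵇ-false {a} {b} = dec-false (a <? b)

-- Related pairs split by the order of their indices, and interchanging the two sums identifies the
-- halves.
handshake : (R : Fin n → Fin n → Bool) → (∀ u v → R u v ≡ R v u) → (∀ u → R u u ≡ false) →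
            sum (λ u → count (R u)) ≡
            sum (λ u → count λ v → (toℕ u <ᵇ toℕ v) ∧ R u v) + sum (λ u → count λ v → (toℕ u <ᵇ toℕ v) ∧ R u v)
handshake R R-sym R-irr = begin
  sum (λ u → count (R u))
    ≡⟨ sum-cong-≗ (λ u → trans (sum-cong-≗ λ v → split u v) (∑-distrib-+ (λ v → ⟦ up u v ⟧) (λ v → ⟦ up v u ⟧))) ⟩
  sum (λ u → count (up u) + count (λ v → up v u))
    ≡⟨ ∑-distrib-+ (λ u → count (up u)) (λ u → count (λ v → up v u)) ⟩
  sum (λ u → count (up u)) + sum (λ u → count (λ v → up v u))
    ≡⟨ cong (sum (λ u → count (up u)) +_) (∑-comm λ u v → ⟦ up v u ⟧) ⟩
  sum (λ u → count (up u)) + sum (λ u → count (up u)) ∎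
  where
  open ≡-Reasoning
  up : Fin _ → Fin _ → Bool
  up u v = (toℕ u <ᵇ toℕ v) ∧ R u v
  split : ∀ u v → ⟦ R u v ⟧ ≡ ⟦ up u v ⟧ + ⟦ up v u ⟧
  split u v with <-cmp (toℕ u) (toℕ v)
  ... | tri< lt _ ngt rewrite <ᵇ-true lt | <ᵇ-false ngt = sym (+-identityʳ _)
  ... | tri> nlt _ gt rewrite <ᵇ-true gt | <ᵇ-false nlt = cong ⟦_⟧ (R-sym u v)
  ... | tri≈ nlt eq ngt rewrite <ᵇ-false nlt | <ᵇ-false ngt =
    cong ⟦_⟧ (trans (cong (R u) (sym (toℕ-injective eq))) (R-irr u))

-- Linear inequalities

infixr 5 _⊕_
_⊕_ : ∀ {a b c d} → a ≤ b → c ≤ d → a + c ≤ b + d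
_⊕_ = +-mono-≤

-- Refutes a linear system: `l ≤ r` is a sum of its inequalities with suitable multiplicities, the
-- equation is left to the ring solver, and `suc d` is the slack.
impossible : ∀ {l r} d → l ≤ r → l ≡ suc d + r → ⊥
impossible {l} {r} d le refl = <-irrefl refl (≤-trans (s≤s (m≤n+m r d)) le)

-- The density hypothesis, cleared of fractions, with Δ eliminated in favour of the number of large
-- colours.
degree-bound : ∀ n δ s k → 2 * n + 5 * δ ≤ 3 * k + 7 → δ + s ≡ k + 1 → 2 * n + 2 * δ ≤ 3 * s + 4
degree-bound n δ s k le eq = +-cancelʳ-≤ (3 * δ + 3) _ _ (begin
  2 * n + 2 * δ + (3 * δ + 3)  ≡⟨ lhs n δ ⟩
  2 * n + 5 * δ + 3            ≤⟨ +-monoˡ-≤ 3 le ⟩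
  3 * k + 7 + 3                ≡⟨ mid k ⟩
  3 * (k + 1) + 7              ≡⟨ cong (λ z → 3 * z + 7) eq ⟨
  3 * (δ + s) + 7              ≡⟨ rhs δ s ⟩
  3 * s + 4 + (3 * δ + 3)      ∎)
  where
  open ≤-Reasoning
  lhs : ∀ n δ → 2 * n + 2 * δ + (3 * δ + 3) ≡ 2 * n + 5 * δ + 3
  lhs = solve-∀
  mid : ∀ k → 3 * k + 7 + 3 ≡ 3 * (k + 1) + 7
  mid = solve-∀
  rhs : ∀ δ s → 3 * (δ + s) + 7 ≡ 3 * s + 4 + (3 * δ + 3)
  rhs = solve-∀

-- The bound gives 2n ≤ 3s, whereas the negated inequality would give 3s + 3 ≤ 2n. The 6 and the 2
-- arise in `common-three`.
three-sets : ∀ {n δ s z} → 2 * n + 2 * δ ≤ 3 * s + 4 → 2 ≤ δ → s ≤ z + 1 → ¬ (s + s + z + 6 ≤ 2 * n + 2)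
three-sets {n} {δ} {s} {z} A B C D = impossible 2 (A ⊕ B ⊕ B ⊕ C ⊕ D) (eq n δ s z)
  where
  eq : ∀ n δ s z → 2 * n + 2 * δ + (2 + (2 + (s + (s + s + z + 6)))) ≡
       3 + (3 * s + 4 + (δ + (δ + (z + 1 + (2 * n + 2)))))
  eq = solve-∀

-- Here `d` and `e` are the degrees of two adjacent vertices, `p` and `q` their numbers of large
-- neighbours. Together the conditions give 3s + 9 ≤ 2n + δ, against 2n + 2δ ≤ 3s + 4.
two-low : ∀ {n δ s k p q d e} → 2 * n + 2 * δ ≤ 3 * s + 4 → δ + s ≡ k + 1 →
          s + p + 3 ≤ n → s + q + 3 ≤ n → d + s ≤ p + k → e + s ≤ q + k → ¬ (k + 2 ≤ e + d)
two-low {n} {δ} {s} {k} {p} {q} {d} {e} A B C D F G H =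
  impossible (δ + 4) (A ⊕ ≤-reflexive (sym B) ⊕ C ⊕ D ⊕ F ⊕ G ⊕ H) (eq n δ s k p q d e)
  where
  eq : ∀ n δ s k p q d e →
       2 * n + 2 * δ + (k + 1 + (s + p + 3 + (s + q + 3 + (d + s + (e + s + (k + 2)))))) ≡
       suc (δ + 4) + (3 * s + 4 + (δ + s + (n + (n + (p + k + (q + k + (e + d)))))))
  eq = solve-∀

-- If m ≤ 4, then 2s ≤ n + 1, which with 2n ≤ 3s forces n ≤ 3; but s + 2 ≤ n and 2n ≤ 3s force n ≥
-- 6. Five colours are wanted so that two of them avoid the three colours on the kite.
low-misses : ∀ {n δ s p m} → 2 * n + 2 * δ ≤ 3 * s + 4 → 2 ≤ δ → s + 2 ≤ n → p + m ≡ s →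
             s + p + 3 ≤ n → 5 ≤ m
low-misses {n} {δ} {s} {p} {m} A B C D E = ≰⇒> λ F →
  impossible 1 (A ⊕ A ⊕ *-monoʳ-≤ 4 B ⊕ *-monoʳ-≤ 2 C ⊕ *-monoʳ-≤ 2 (≤-reflexive (sym D)) ⊕ *-monoʳ-≤ 2 E ⊕ *-monoʳ-≤ 2 F)
    (eq n δ s p m)
  where
  eq : ∀ n δ s p m →
       2 * n + 2 * δ + (2 * n + 2 * δ + (4 * 2 + (2 * (s + 2) + (2 * s + (2 * (s + p + 3) + 2 * m))))) ≡
       2 + (3 * s + 4 + (3 * s + 4 + (4 * δ + (2 * n + (2 * (p + m) + (2 * n + 2 * 4))))))
  eq = solve-∀

module _ (f : Colouring n k) {u : Fin n} {i : Fin k} where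

  present-true : ∀ {v} → f u v ≡ just i → present f u i ≡ true
  present-true e = dec-true (present? f u i) (_ , e)

  present-false : Missing f u i → present f u i ≡ false
  present-false m = dec-false (present? f u i) λ (v , e) → m v e

  absent-missing : present f u i ≡ false → Missing f u i
  absent-missing e v e′ = contradiction (trans (sym (present-true e′)) e) λ ()

-- Neighbourhoods along large colours

module Counting (G : Graph n) (¬colourable : ¬ Colourable (adj G) k)
  (degree-sum : ∀ {u v} → adj G u v ≡ true → k + 2 ≤ deg G u + deg G v)
  {h : Colouring n k} {x y c : Fin n} {b : Fin k}
  (base : Reduction.Base (adj G) ¬colourable h x y c b)
  (coloured-edge : ∀ {u v i} → h u v ≡ just i → adj G u v ≡ true)
  (x-degree : deg G x ≡ 2 + count (present h x))
  (other-degree : ∀ {u} → u ≢ x → u ≢ y → u ≢ c → deg G u ≡ count (present h u))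
  (x-minimal : ∀ u → deg G x ≤ deg G u)
  (dense : 2 * n + 5 * deg G x ≤ 3 * k + 7)
  where
  open Reduction (adj G) ¬colourable
  open Configurations base
  module Exchanged = Configurations (exchange base)

  -- A colour is large if it is missing at x and different from b; N u holds the neighbours of u
  -- along large colours.
  large : Fin k → Bool
  large i = not (only b i) ∧ not (present h x i)

  large⇒Large : ∀ {i} → large i ≡ true → Large i
  large⇒Large {i} e with i≢b , xi ← ∧-split {not (only b i)} e =
    only-false (not-true i≢b) , absent-missing h (not-true xi)

  s : ℕ
  s = count large

  N : Fin n → Fin n → Bool
  N u w = colourIn large (h u w)

  size : Fin n → ℕ
  size u = count (N u)

  misses : Fin n → ℕ
  misses u = count λ i → large i ∧ not (present h u i)

  N-colour : ∀ {u w} → N u w ≡ true → ∃ λ α → h u w ≡ just α × Large α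
  N-colour {u} {w} e with h u w
  ... | just α = α , refl , large⇒Large e

  N-sym : ∀ u w → N u w ≡ N w u
  N-sym u w = cong (colourIn large) (symmetric proper u w)

  N-loopless : ∀ u → N u u ≡ false
  N-loopless u = ¬-not λ e → let _ , e′ , _ = N-colour e in loopless e′ refl

  N-x : ∀ u → N u x ≡ false
  N-x u = ¬-not λ e → let _ , e′ , _ , xα = N-colour e in xα _ (rev e′)

  N-≢ : ∀ {u v w} → N u w ≡ true → N u v ≡ false → w ≢ v
  N-≢ e e′ refl = contradiction (trans (sym e) e′) λ ()

  size-colours : ∀ u → size u ≡ count (λ i → large i ∧ present h u i)
  size-colours = count-neighbours proper large

  size+misses : ∀ u → size u + misses u ≡ s
  size+misses u = begin
    size u + misses u
      ≡⟨ cong (_+ misses u) (size-colours u) ⟩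
    count (λ i → large i ∧ present h u i) + misses u
      ≡⟨ ∑-distrib-+ (λ i → ⟦ large i ∧ present h u i ⟧) (λ i → ⟦ large i ∧ not (present h u i) ⟧) ⟨
    sum (λ i → ⟦ large i ∧ present h u i ⟧ + ⟦ large i ∧ not (present h u i) ⟧)
      ≡⟨ sum-cong-≗ (λ i → split (large i) (present h u i)) ⟩
    s ∎
    where
    open ≡-Reasoning
    split : ∀ a p → ⟦ a ∧ p ⟧ + ⟦ a ∧ not p ⟧ ≡ ⟦ a ⟧
    split true true = refl
    split true false = refl
    split false _ = refl

  full-size : ∀ {u} → (∀ {i} → Large i → ¬ Missing h u i) → size u ≡ s
  full-size {u} full = begin
    size u             ≡⟨ +-identityʳ (size u) ⟨
    size u + 0         ≡⟨ cong (size u +_) (sum-zero λ i → none i) ⟨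
    size u + misses u  ≡⟨ size+misses u ⟩
    s                  ∎
    where
    open ≡-Reasoning
    none : ∀ i → ⟦ large i ∧ not (present h u i) ⟧ ≡ 0
    none i = cong ⟦_⟧ (¬-not λ e → let l , p = ∧-split {large i} e in
                                   full (large⇒Large l) (absent-missing h (not-true p)))

  -- Two edges at x are uncoloured, so x misses k - δ + 2 colours, and `b` is one of them.
  x-degree+s : deg G x + s ≡ k + 1
  x-degree+s = begin
    deg G x + s                                    ≡⟨ cong (_+ s) x-degree ⟩
    2 + count (present h x) + s                    ≡⟨ rearrange (count (present h x)) s ⟩
    count (present h x) + (1 + s) + 1              ≡⟨ cong (λ z → count (present h x) + z + 1) (sym absent) ⟩
    count (present h x) + count (not ∘ present h x) + 1 ≡⟨ cong (_+ 1) (count-complement (present h x)) ⟩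
    k + 1                                          ∎
    where
    open ≡-Reasoning
    rearrange : ∀ a z → 2 + a + z ≡ a + (1 + z) + 1
    rearrange = solve-∀
    pointwise : ∀ i → ⟦ not (present h x i) ⟧ ≡ ⟦ only b i ⟧ + ⟦ large i ⟧
    pointwise i = case i ≟ b of λ where
      (yes refl) → trans (cong (⟦_⟧ ∘ not) (present-false h xb))
                         (sym (cong₂ (λ a l → ⟦ a ⟧ + ⟦ l ⟧) (only-refl b)
                                     (cong (λ a → not a ∧ not (present h x b)) (only-refl b))))
      (no i≢b) → sym (cong₂ (λ a l → ⟦ a ⟧ + ⟦ l ⟧) (only-≢ i≢b) (cong (λ a → not a ∧ not (present h x i)) (only-≢ i≢b)))
    absent : count (not ∘ present h x) ≡ 1 + s
    absent = trans (sum-cong-≗ pointwise)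
      (sum-+ {k} (count-only b) refl)

  -- Inclusion and exclusion: at most k colours are present at `u` or large.
  degree+s : ∀ {u} → u ≢ x → u ≢ y → u ≢ c → deg G u + s ≤ size u + k
  degree+s {u} u≢x u≢y u≢c = begin
    deg G u + s                                          ≡⟨ cong (_+ s) (other-degree u≢x u≢y u≢c) ⟩
    count (present h u) + s                              ≡⟨ ∑-distrib-+ (λ i → ⟦ present h u i ⟧) (λ i → ⟦ large i ⟧) ⟨
    sum (λ i → ⟦ present h u i ⟧ + ⟦ large i ⟧)          ≤⟨ sum-mono (λ i → inclusion (present h u i) (large i)) ⟩
    sum (λ i → ⟦ large i ∧ present h u i ⟧ + 1)          ≡⟨ ∑-distrib-+ (λ i → ⟦ large i ∧ present h u i ⟧) (λ _ → 1) ⟩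
    count (λ i → large i ∧ present h u i) + sum {k} (λ _ → 1) ≡⟨ cong₂ _+_ (sym (size-colours u)) (sum-ones k) ⟩
    size u + k                                           ∎
    where
    open ≤-Reasoning
    inclusion : ∀ p l → ⟦ p ⟧ + ⟦ l ⟧ ≤ ⟦ l ∧ p ⟧ + 1
    inclusion true true = ≤-refl
    inclusion true false = ≤-refl
    inclusion false true = ≤-refl
    inclusion false false = z≤n

  δ≥2 : 2 ≤ deg G x
  δ≥2 = subst (2 ≤_) (sym x-degree) (m≤m+n 2 _)

  bound : 2 * n + 2 * deg G x ≤ 3 * s + 4
  bound = degree-bound n (deg G x) s k dense x-degree+s

  -- Large neighbours of y or c fall to fans and Kierstead paths; these are the vertices left to the
  -- kite.
  record Outside (u : Fin n) : Set where
    field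
      u≢x : u ≢ x
      u≢y : u ≢ y
      u≢c : u ≢ c
      Nyu : N y u ≡ false
      Ncu : N c u ≡ false

  y-size : size y ≡ s
  y-size = full-size y-full

  c-size : size c ≡ s
  c-size = full-size Exchanged.y-full

  s+2≤n : s + 2 ≤ n
  s+2≤n = begin
    s + 2                                                    ≡⟨ sum-+ {n} y-size (sum-+ {n} (count-only x) (count-only y)) ⟨
    sum (λ w → ⟦ N y w ⟧ + (⟦ only x w ⟧ + ⟦ only y w ⟧))    ≤⟨ sum-mono pointwise ⟩
    sum {n} (λ _ → 1)                                        ≡⟨ sum-ones n ⟩
    n                                                        ∎
    where
    open ≤-Reasoning
    pointwise : ∀ w → ⟦ N y w ⟧ + (⟦ only x w ⟧ + ⟦ only y w ⟧) ≤ 1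
    pointwise w with w ≟ x | w ≟ y
    ... | yes refl | yes refl = ⊥-elim (x≢y refl)
    ... | yes refl | no _ rewrite N-x y = ≤-refl
    ... | no _ | yes refl rewrite N-loopless y = ≤-refl
    ... | no _ | no _ = ≤-trans (≤-reflexive (+-identityʳ _)) (⟦⟧≤1 (N y w))

  module _ {u} (out : Outside u) where
    open Outside out

    -- Pigeonhole; the 3 counts x, y and `u`, which lie in neither set.
    common-two : n < s + size u + 3 → ∃ λ w → N y w ≡ true × N u w ≡ true
    common-two lt with any? (λ w → N y w ≟ᵇ true ×-dec N u w ≟ᵇ true)
    ... | yes found = found
    ... | no none = contradiction total (<⇒≱ lt)
      where
      open ≤-Reasoning
      pointwise : ∀ w → (⟦ N y w ⟧ + ⟦ N u w ⟧) + (⟦ only x w ⟧ + (⟦ only y w ⟧ + ⟦ only u w ⟧)) ≤ 1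
      pointwise w with w ≟ x | w ≟ y | w ≟ u
      ... | yes refl | yes refl | _ = ⊥-elim (x≢y refl)
      ... | yes refl | no _ | yes refl = ⊥-elim (u≢x refl)
      ... | no _ | yes refl | yes refl = ⊥-elim (u≢y refl)
      ... | yes refl | no _ | no _ rewrite N-x y | N-x u = ≤-refl
      ... | no _ | yes refl | no _ rewrite N-loopless y | N-sym u y | Nyu = ≤-refl
      ... | no _ | no _ | yes refl rewrite N-loopless u | Nyu = ≤-refl
      ... | no _ | no _ | no _ with N y w in e | N u w in e′
      ...   | true | true = ⊥-elim (none (w , e , e′))
      ...   | true | false = ≤-refl
      ...   | false | true = ≤-refl
      ...   | false | false = z≤n
      total : s + size u + 3 ≤ n
      total = begin
        s + size u + 3
          ≡⟨ sum-+ {n} (sum-+ {n} y-size refl) (sum-+ {n} (count-only x) (sum-+ {n} (count-only y) (count-only u))) ⟨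
        sum (λ w → (⟦ N y w ⟧ + ⟦ N u w ⟧) + (⟦ only x w ⟧ + (⟦ only y w ⟧ + ⟦ only u w ⟧)))
          ≤⟨ sum-mono pointwise ⟩
        sum {n} (λ _ → 1)
          ≡⟨ sum-ones n ⟩
        n ∎

    -- Otherwise a vertex lies in at most two of the three sets, except possibly the ends of the
    -- `μ`-edges at y and c, whence the 2. Moreover x and `u` lie in none and y and c in at most one
    -- each, which saves 2 + 2 + 1 + 1 = 6.
    common-three : s ≤ size u + 1 → ∀ μ → ∃ λ w → (N y w ≡ true × N c w ≡ true × N u w ≡ true) ×
                   (h y w ≢ just μ × h c w ≢ just μ)
    common-three high μ
      with any? (λ w → (N y w ≟ᵇ true ×-dec N c w ≟ᵇ true ×-dec N u w ≟ᵇ true) ×-dec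
                       (¬? (maybe-≡-dec _≟_ (h y w) (just μ)) ×-dec ¬? (maybe-≡-dec _≟_ (h c w) (just μ))))
    ... | yes found = found
    ... | no none = ⊥-elim (three-sets {n} bound δ≥2 high total)
      where
      open ≤-Reasoning
      sets special excused : Fin n → ℕ
      sets w = (⟦ N y w ⟧ + ⟦ N c w ⟧) + ⟦ N u w ⟧
      special w = (⟦ only x w ⟧ + ⟦ only x w ⟧ + (⟦ only y w ⟧ + ⟦ only c w ⟧)) + (⟦ only u w ⟧ + ⟦ only u w ⟧)
      excused w = ⟦ hasColour (h y w) μ ⟧ + ⟦ hasColour (h c w) μ ⟧
      three≤ : ∀ a b d → ¬ (a ≡ true × b ≡ true × d ≡ true) → (⟦ a ⟧ + ⟦ b ⟧) + ⟦ d ⟧ ≤ 2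
      three≤ true true true na = ⊥-elim (na (refl , refl , refl))
      three≤ true true false _ = ≤-refl
      three≤ true false true _ = ≤-refl
      three≤ true false false _ = s≤s z≤n
      three≤ false true true _ = ≤-refl
      three≤ false true false _ = s≤s z≤n
      three≤ false false true _ = s≤s z≤n
      three≤ false false false _ = z≤n
      three≤3 : ∀ a b d → (⟦ a ⟧ + ⟦ b ⟧) + ⟦ d ⟧ ≤ 3
      three≤3 a b d = (⟦⟧≤1 a ⊕ ⟦⟧≤1 b) ⊕ ⟦⟧≤1 d
      pointwise : ∀ w → sets w + special w ≤ 2 + excused w
      pointwise w with w ≟ x | w ≟ y | w ≟ c | w ≟ u
      ... | yes refl | yes refl | _ | _ = ⊥-elim (x≢y refl)
      ... | yes refl | no _ | yes refl | _ = ⊥-elim (x≢c refl)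
      ... | yes refl | no _ | no _ | yes refl = ⊥-elim (u≢x refl)
      ... | no _ | yes refl | yes refl | _ = ⊥-elim (y≢c refl)
      ... | no _ | yes refl | no _ | yes refl = ⊥-elim (u≢y refl)
      ... | no _ | no _ | yes refl | yes refl = ⊥-elim (u≢c refl)
      ... | yes refl | no _ | no _ | no _ rewrite N-x y | N-x c | N-x u = m≤m+n 2 _
      ... | no _ | yes refl | no _ | no _ rewrite N-loopless y | N-sym u y | Nyu =
        ≤-trans (+-monoˡ-≤ 1 (≤-trans (≤-reflexive (+-identityʳ _)) (⟦⟧≤1 (N c y)))) (m≤m+n 2 _)
      ... | no _ | no _ | yes refl | no _ rewrite N-loopless c | N-sym u c | Ncu =
        ≤-trans (+-monoˡ-≤ 1 (≤-trans (≤-reflexive (trans (+-identityʳ _) (+-identityʳ _))) (⟦⟧≤1 (N y c)))) (m≤m+n 2 _)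
      ... | no _ | no _ | no _ | yes refl rewrite N-loopless u | Nyu | Ncu = m≤m+n 2 _
      ... | no _ | no _ | no _ | no _ = ≤-trans (≤-reflexive (+-identityʳ _)) ordinary
        where
        ordinary : sets w ≤ 2 + excused w
        ordinary with maybe-≡-dec _≟_ (h y w) (just μ) | maybe-≡-dec _≟_ (h c w) (just μ)
        ... | yes _ | _ = ≤-trans (three≤3 (N y w) (N c w) (N u w)) (m≤m+n 3 _)
        ... | no _ | yes _ = three≤3 (N y w) (N c w) (N u w)
        ... | no ¬p | no ¬q = ≤-trans (three≤ (N y w) (N c w) (N u w) λ t → none (w , t , ¬p , ¬q)) (m≤m+n 2 _)
      at-most-one : ∀ v → sum (λ w → ⟦ hasColour (h v w) μ ⟧) ≤ 1
      at-most-one v = count≤1 (λ w → hasColour (h v w) μ) λ e e′ → unique proper (hasColour-just e) (hasColour-just e′)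
      total : s + s + size u + 6 ≤ 2 * n + 2
      total = begin
        s + s + size u + 6
          ≡⟨ sum-+ {n} (sum-+ {n} (sum-+ {n} y-size c-size) refl)
               (sum-+ {n} (sum-+ {n} (sum-+ {n} (count-only x) (count-only x)) (sum-+ {n} (count-only y) (count-only c)))
                 (sum-+ {n} (count-only u) (count-only u))) ⟨
        sum (λ w → sets w + special w)          ≤⟨ sum-mono pointwise ⟩
        sum (λ w → 2 + excused w)               ≡⟨ sum-+ {n} (sum-const n 2) (sum-+ {n} refl refl) ⟩
        n * 2 + (sum (λ w → ⟦ hasColour (h y w) μ ⟧) + sum (λ w → ⟦ hasColour (h c w) μ ⟧))
                                                ≤⟨ ≤-reflexive (*-comm n 2) ⊕ at-most-one y ⊕ at-most-one c ⟩
        2 * n + 2                               ∎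

    misses≤1 : n < s + size u + 3 → misses u ≤ 1
    misses≤1 lt = ≮⇒≥ λ two →
      let w , Nyw , Nuw = common-two lt
          α , yw , _ , xα = N-colour Nyw
          γ , uw , large-γ = N-colour Nuw
          P = λ i → large i ∧ not (present h u i)
          i , Pi , _ = pick P [] (≤-trans (s≤s z≤n) two)
          j , Pj , j≢i = pick P (i ∷ []) two
          li , ui = ∧-split {large i} Pi
          lj , uj = ∧-split {large j} Pj
      in kierstead-missing yw (rev uw) xα large-γ (N-≢ Nuw (trans (N-sym u c) Ncu))
           u≢y u≢c (≢-sym (All.head j≢i)) (large⇒Large li) (large⇒Large lj)
           (absent-missing h (not-true ui)) (absent-missing h (not-true uj))

    large-size : n < s + size u + 3 → s ≤ size u + 1
    large-size lt = ≤-trans (≤-reflexive (sym (size+misses u))) (+-monoʳ-≤ (size u) (misses≤1 lt))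

  -- Only δ − 1 colours are not large, so N v has an element u, and d(u) + d(v) ≥ Δ + 2 forces N u
  -- to have many.
  not-low : ∀ {v} → Outside v → ¬ (s + size v + 3 ≤ n)
  not-low {v} out low =
    let u , Nvu , _ = pick (N v) [] size>0
        μ , vu , large-μ = N-colour Nvu
        out-u = outside-u Nvu
        high = large-size out-u (≰⇒> λ low-u → two-low {n} bound x-degree+s low low-u
                 (degree+s v≢x v≢y v≢c)
                 (degree+s (Outside.u≢x out-u) (Outside.u≢y out-u) (Outside.u≢c out-u))
                 (degree-sum (coloured-edge (rev vu))))
        -- The tail of the kite has colour `μ`, which must differ from the colours of `yw` and `cw`.
        w , (Nyw , Ncw , Nuw) , yw≢μ , cw≢μ = common-three out-u high μ
        α , yw , _ , xα = N-colour Nyw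
        β , cw , _ , xβ = N-colour Ncw
        γ , uw , large-γ = N-colour Nuw
        open Kite yw cw (rev uw) xα xβ large-γ (Outside.u≢y out-u) (Outside.u≢c out-u)
        p , Pp , p∉ = pick P (α ∷ β ∷ γ ∷ []) (≤-trans (n≤1+n 4) many)
        q , Pq , q∉ = pick P (p ∷ α ∷ β ∷ γ ∷ []) many
        lp , vp = missed Pp
        lq , vq = missed Pq
    in tailed-kite (rev vu) v≢y v≢c (≢-sym (N-≢ Nyw Nyv)) large-μ
         (λ e → yw≢μ (trans yw (cong just (sym e)))) (λ e → cw≢μ (trans cw (cong just (sym e))))
         (≢-sym (All.head q∉)) (proj₁ lp) (proj₁ lq)
         p∉ (All.tail q∉) (proj₂ lp) (proj₂ lq) vp vq
    where
    open Outside out renaming (u≢x to v≢x; u≢y to v≢y; u≢c to v≢c; Nyu to Nyv; Ncu to Ncv)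
    P : Fin k → Bool
    P i = large i ∧ not (present h v i)
    missed : ∀ {i} → P i ≡ true → Large i × Missing h v i
    missed {i} e with l , m ← ∧-split {large i} e = large⇒Large l , absent-missing h (not-true m)
    many : 5 ≤ misses v
    many = low-misses {n} bound δ≥2 s+2≤n (size+misses v) low
    size>0 : 0 < size v
    size>0 = +-cancelʳ-≤ k 1 (size v) (begin
      1 + k          ≡⟨ trans (+-comm 1 k) (sym x-degree+s) ⟩
      deg G x + s    ≤⟨ +-monoˡ-≤ s (x-minimal v) ⟩
      deg G v + s    ≤⟨ degree+s v≢x v≢y v≢c ⟩
      size v + k     ∎)
      where open ≤-Reasoning
    outside-u : ∀ {u} → N v u ≡ true → Outside u
    outside-u {u} Nvu = record
      { u≢x = N-≢ Nvu (N-x v)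
      ; u≢y = u≢y ; u≢c = u≢c
      -- Otherwise x, y, u, v is a Kierstead path, and `v` could not miss two large colours.
      ; Nyu = ¬-not λ Nyu →
          let α , yu , _ , xα = N-colour Nyu in
          kierstead-missing yu (rev vu) xα large-μ u≢c v≢y v≢c (≢-sym (All.head j≢i))
            (proj₁ i-missed) (proj₁ j-missed) (proj₂ i-missed) (proj₂ j-missed)
      ; Ncu = ¬-not λ Ncu →
          let α , cu , _ , xα = N-colour Ncu in
          Exchanged.kierstead-missing cu (rev vu) xα large-μ u≢y v≢c v≢y (≢-sym (All.head j≢i))
            (proj₁ i-missed) (proj₁ j-missed) (proj₂ i-missed) (proj₂ j-missed) }
      where
      vu = proj₁ (proj₂ (N-colour Nvu))
      large-μ = proj₂ (proj₂ (N-colour Nvu))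
      u≢y = N-≢ Nvu (trans (N-sym v y) Nyv)
      u≢c = N-≢ Nvu (trans (N-sym v c) Ncv)
      first = pick P [] (≤-trans (s≤s z≤n) many)
      i-missed = missed (proj₁ (proj₂ first))
      second = pick P (proj₁ first ∷ []) (≤-trans (s≤s (s≤s z≤n)) many)
      j≢i = proj₂ (proj₂ second)
      j-missed = missed (proj₁ (proj₂ second))

  no-common-missing : ∀ {u i} → u ≢ x → u ≢ y → u ≢ c → Missing h x i → ¬ Missing h u i
  no-common-missing {u} {i} u≢x u≢y u≢c xi ui with N y u in Nyu | N c u in Ncu
  ... | true | _ = let α , yu , _ , xα = N-colour Nyu in fan-missing yu xα u≢c xi ui
  ... | false | true = let α , cu , _ , xα = N-colour Ncu in Exchanged.fan-missing cu xα u≢y xi ui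
  ... | false | false =
    let out = record { u≢x = u≢x ; u≢y = u≢y ; u≢c = u≢c ; Nyu = Nyu ; Ncu = Ncu }
        -- Excluding `i` keeps it different from the colours of `yw` and `cw`; it differs from that
        -- of `wu` because `u` misses it.
        w , (Nyw , Ncw , Nuw) , yw≢i , cw≢i = common-three out (large-size out (≰⇒> (not-low out))) i
        α , yw , _ , xα = N-colour Nyw
        β , cw , _ , xβ = N-colour Ncw
        γ , uw , large-γ = N-colour Nuw
        open Kite yw cw (rev uw) xα xβ large-γ u≢y u≢c
    in kite-missing (λ e → yw≢i (trans yw (cong just (sym e)))) (λ e → cw≢i (trans cw (cong just (sym e)))) xi ui

-- Degrees and edge numbers as sums

length-filter-tabulate : {A : Set} (P : A → Bool) (g : Fin n → A) →
                         length (filterᵇ P (tabulate g)) ≡ count (P ∘ g)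
length-filter-tabulate {zero} P g = refl
length-filter-tabulate {suc n} P g with P (g zero)
... | true = cong suc (length-filter-tabulate P (g ∘ suc))
... | false = length-filter-tabulate P (g ∘ suc)

sum-map-tabulate : {A : Set} (F : A → ℕ) (g : Fin n → A) →
                   ListAction.sum (map F (tabulate g)) ≡ sum (F ∘ g)
sum-map-tabulate {zero} F g = refl
sum-map-tabulate {suc n} F g = cong (F (g zero) +_) (sum-map-tabulate F (g ∘ suc))

≤-foldr-⊔ : {A : Set} (F : A → ℕ) {xs : List A} {x : A} → x ∈ xs → F x ≤ foldr _⊔_ 0 (map F xs)
≤-foldr-⊔ F (here refl) = m≤m⊔n _ _
≤-foldr-⊔ F (there x∈) = ≤-trans (≤-foldr-⊔ F x∈) (m≤n⊔m _ _)

foldr-⊓-≤ : {A : Set} (F : A → ℕ) {e : ℕ} {xs : List A} {x : A} → x ∈ xs → foldr _⊓_ e (map F xs) ≤ F x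
foldr-⊓-≤ F (here refl) = m⊓n≤m _ _
foldr-⊓-≤ F (there x∈) = ≤-trans (m⊓n≤n _ _) (foldr-⊓-≤ F x∈)

foldr-⊓-attained : {A : Set} (F : A → ℕ) (a : A) (xs : List A) → ∃ λ x → foldr _⊓_ (F a) (map F xs) ≡ F x
foldr-⊓-attained F a [] = a , refl
foldr-⊓-attained F a (x ∷ xs) with ⊓-sel (F x) (foldr _⊓_ (F a) (map F xs))
... | inj₁ e = x , e
... | inj₂ e = let z , e′ = foldr-⊓-attained F a xs in z , trans e e′

module _ (G : Graph n) where

  deg≡count : ∀ u → deg G u ≡ count (adj G u)
  deg≡count u = length-filter-tabulate (adj G u) id

  deg≤maxDeg : ∀ u → deg G u ≤ maxDeg G
  deg≤maxDeg u = ≤-foldr-⊔ (deg G) (∈-allFin u)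

  numEdges≡sum : numEdges G ≡ sum λ u → count λ v → (toℕ u <ᵇ toℕ v) ∧ adj G u v
  numEdges≡sum = trans (sum-map-tabulate {n} _ id) 
    (sum-cong-≗ {n} λ u → length-filter-tabulate (λ v → (toℕ u <ᵇ toℕ v) ∧ adj G u v) id)

minDeg-attained : (G : Graph (suc n)) → ∃ λ x → minDeg G ≡ deg G x
minDeg-attained G = foldr-⊓-attained (deg G) zero (allFin _)

minDeg≤deg : (G : Graph (suc n)) → ∀ u → minDeg G ≤ deg G u
minDeg≤deg G u = foldr-⊓-≤ (deg G) (∈-allFin u)

-- Translation between the two notions of colouring

module FromEdgeColouring {E : Fin n → Fin n → Bool} (E-symmetric : ∀ u v → E u v ≡ E v u)
                         (colouring : EdgeColouring E k) where
  private
    c = proj₁ colouring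
    -- The value `a` is separate from its equation so that a match on it still supplies the edge
    -- proof demanded by `c`. Such proofs are all equal, so the colour does not depend on the
    -- choice.
    go : ∀ u v a → E u v ≡ a → Maybe (Fin k)
    go u v true e = just (c u v e)
    go u v false e = nothing

  f : Colouring n k
  f u v = go u v (E u v) refl

  f-coloured : ∀ {u v} (e : E u v ≡ true) → f u v ≡ just (c u v e)
  f-coloured {u} {v} = at (E u v) refl
    where
    at : ∀ a e (e′ : E u v ≡ true) → go u v a e ≡ just (c u v e′)
    at true e e′ = cong (just ∘ c u v) (Decidable⇒UIP.≡-irrelevant _≟ᵇ_ e e′)
    at false e e′ = contradiction (trans (sym e) e′) λ ()

  f-uncoloured : ∀ {u v} → E u v ≡ false → f u v ≡ nothing
  f-uncoloured {u} {v} = at (E u v) refl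
    where
    at : ∀ a e → E u v ≡ false → go u v a e ≡ nothing
    at true e e′ = contradiction (trans (sym e) e′) λ ()
    at false e e′ = refl

  f-just : ∀ {u v i} → f u v ≡ just i → Σ (E u v ≡ true) λ e → c u v e ≡ i
  f-just {u} {v} {i} = at (E u v) refl
    where
    at : ∀ a e → go u v a e ≡ just i → Σ (E u v ≡ true) λ e → c u v e ≡ i
    at true e refl = e , refl

  f-proper : Proper f
  f-proper .symmetric u v with E u v ≟ᵇ true
  ... | yes e = let e′ = trans (sym (E-symmetric u v)) e in
    trans (f-coloured e) (trans (cong just (proj₁ (proj₂ colouring) u v e e′)) (sym (f-coloured e′)))
  ... | no ¬e = let e = ¬-not ¬e in
    trans (f-uncoloured e) (sym (f-uncoloured (trans (sym (E-symmetric u v)) e)))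
  f-proper .unique {u} {v} {w} p q with v ≟ w
  ... | yes v≡w = v≡w
  ... | no v≢w = let e , ce = f-just p; e′ , ce′ = f-just q in
    ⊥-elim (proj₂ (proj₂ colouring) u v w e e′ v≢w (trans ce (sym ce′)))

toEdgeColouring : {E : Fin n → Fin n → Bool} → Colourable E k → EdgeColourable E k
toEdgeColouring {n} {k} {E} (g , pg , total) = c , c-sym , c-proper
  where
  value : ∀ {u v} → E u v ≡ true → ∃ λ i → g u v ≡ just i
  value {u} {v} e with g u v in eq
  ... | just i = i , refl
  ... | nothing = ⊥-elim (total u v e eq)
  c : ∀ u v → E u v ≡ true → Fin k
  c u v e = proj₁ (value e)
  c-sym : ∀ u v p q → c u v p ≡ c v u q
  c-sym u v p q = just-injective (trans (sym (proj₂ (value p))) (trans (symmetric pg u v) (proj₂ (value q))))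
  c-proper : ∀ u v w p q → v ≢ w → c u v p ≢ c u w q
  c-proper u v w p q v≢w eq = v≢w (unique pg (proj₂ (value p)) (trans (proj₂ (value q)) (cong just (sym eq))))

-- Colourings of the graph minus one edge

record Almost (G : Graph n) (f : Colouring n k) (x y : Fin n) : Set where
  field
    proper  : Proper f
    edge    : adj G x y ≡ true
    inside  : ∀ {u v i} → f u v ≡ just i → adj G u v ≡ true
    outside : ∀ {u v} → adj G u v ≡ true → f u v ≡ nothing → SameEdge x y u v
    hole    : f x y ≡ nothing

coloured : Maybe (Fin k) → Bool
coloured = colourIn λ _ → true

degree-formula : (G : Graph n) {f : Colouring n k} → Proper f → ∀ u (extra : Fin n → ℕ) →
                 (∀ w → ⟦ adj G u w ⟧ ≡ extra w + ⟦ coloured (f u w) ⟧) →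
                 deg G u ≡ sum extra + count (present f u)
degree-formula G {f} pf u extra e = begin
  deg G u                                        ≡⟨ deg≡count G u ⟩
  count (adj G u)                                ≡⟨ sum-cong-≗ e ⟩
  sum (λ w → extra w + ⟦ coloured (f u w) ⟧)     ≡⟨ ∑-distrib-+ extra (λ w → ⟦ coloured (f u w) ⟧) ⟩
  sum extra + count (λ w → coloured (f u w))     ≡⟨ cong (sum extra +_) (count-neighbours pf (λ _ → true) u) ⟩
  sum extra + count (present f u)                ∎
  where open ≡-Reasoning

module _ {G : Graph n} {f : Colouring n k} {x y : Fin n} (almost : Almost G f x y) where
  open Almost almost

  adj-≢ : ∀ {u v} → adj G u v ≡ true → u ≢ v
  adj-≢ {u} e refl = contradiction (trans (sym e) (irrefl G u)) λ ()

  almost-flip : Almost G f y x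
  almost-flip = record
    { proper = proper ; edge = trans (adj-sym G y x) edge ; inside = inside
    ; outside = λ e e′ → Sum.swap (outside e e′)
    ; hole = trans (symmetric proper y x) hole }

  adj-coloured : ∀ {u w} → ¬ SameEdge x y u w → ⟦ adj G u w ⟧ ≡ ⟦ coloured (f u w) ⟧
  adj-coloured {u} {w} ne with f u w in e
  ... | just _ = cong ⟦_⟧ (inside e)
  ... | nothing = cong ⟦_⟧ (¬-not λ a → ne (outside a e))

  end-degree : deg G x ≡ 1 + count (present f x)
  end-degree = trans (degree-formula G proper x (λ w → ⟦ only y w ⟧) pointwise)
                     (cong (_+ count (present f x)) (count-only y))
    where
    pointwise : ∀ w → ⟦ adj G x w ⟧ ≡ ⟦ only y w ⟧ + ⟦ coloured (f x w) ⟧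
    pointwise w = case w ≟ y of λ where
      (yes refl) → trans (cong ⟦_⟧ edge) (sym (cong₂ (λ a m → ⟦ a ⟧ + ⟦ coloured m ⟧) (only-refl w) hole))
      (no w≢y) → trans (adj-coloured λ { (inj₁ (_ , e)) → w≢y e ; (inj₂ (e , _)) → adj-≢ edge e })
                       (cong (λ a → ⟦ a ⟧ + ⟦ coloured (f x w) ⟧) (sym (only-≢ w≢y)))

  module _ (¬colourable : ¬ Colourable (adj G) k) where

    -- A colour missing at both ends could be given to xy.
    ends-disjoint : ∀ {i} → Missing f x i → ¬ Missing f y i
    ends-disjoint {i} xi yi = ¬colourable
      (update f x y (just i) , update-proper f proper (λ { _ refl → xi , yi }) , total)
      where
      total : ∀ u v → adj G u v ≡ true → update f x y (just i) u v ≢ nothing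
      total u v a e = case sameEdge? x y u v of λ where
        (yes s) → contradiction (trans (sym (update-same f s)) e) λ ()
        (no ¬s) → ¬s (outside a (trans (sym (update-other f ¬s)) e))

-- No colour is missing at two vertices

module Extremal (G : Graph n) (¬colourable : ¬ Colourable (adj G) k)
  (degree-sum : ∀ {u v} → adj G u v ≡ true → k + 2 ≤ deg G u + deg G v)
  {x : Fin n} (x-minimal : ∀ u → deg G x ≤ deg G u)
  (dense : 2 * n + 5 * deg G x ≤ 3 * k + 7)
  where
  open Reduction (adj G) ¬colourable

  module _ {f : Colouring n k} {y : Fin n} (almost : Almost G f x y) where
    open Almost almost

    module _ {c : Fin n} {b : Fin k} (yb : Missing f y b) (xc : f x c ≡ just b) where

      private
        D? = sameEdge? x c
        h = without f D?
        x≢y = adj-≢ almost edge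
        x≢c = adj-≢ almost (inside xc)
        y≢c : y ≢ c
        y≢c refl = contradiction (trans (sym hole) xc) λ ()

        base : Base h x y c b
        base = record
          { proper = without-proper f D? proper sameEdge-flip
          ; gap = λ a e → [ inj₂ , inj₁ ∘ outside a ]′ (without-nothing f D? e)
          ; loopless = λ e → adj-≢ almost (inside (proj₂ (without-inv f D? e)))
          ; x≢y = x≢y ; x≢c = x≢c ; y≢c = y≢c
          ; xb = removed-missing f D? proper (inj₁ (refl , refl)) xc
          ; yb = without-missing f D? yb
          ; cb = removed-missing f D? proper (inj₂ (refl , refl)) (trans (symmetric proper c x) xc) }

        adj-h : ∀ {u w} → ¬ SameEdge x y u w → ¬ SameEdge x c u w → ⟦ adj G u w ⟧ ≡ ⟦ coloured (h u w) ⟧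
        adj-h ¬xy ¬xc = trans (adj-coloured almost ¬xy) (cong (⟦_⟧ ∘ coloured) (sym (without-other f D? ¬xc)))

        x-degree : deg G x ≡ 2 + count (present h x)
        x-degree = trans (degree-formula G (Base.proper base) x (λ w → ⟦ only y w ⟧ + ⟦ only c w ⟧) pointwise)
                         (cong (_+ count (present h x)) (sum-+ {n} (count-only y) (count-only c)))
          where
          pointwise : ∀ w → ⟦ adj G x w ⟧ ≡ ⟦ only y w ⟧ + ⟦ only c w ⟧ + ⟦ coloured (h x w) ⟧
          pointwise w = case (w ≟ y) , (w ≟ c) of λ where
            (yes refl , _) → trans (cong ⟦_⟧ edge) (sym (cong₂ _+_
              (cong₂ (λ a b → ⟦ a ⟧ + ⟦ b ⟧) (only-refl y) (only-≢ y≢c))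
              (cong (⟦_⟧ ∘ coloured) (trans (without-other f D? λ { (inj₁ (_ , e)) → y≢c e ; (inj₂ (e , _)) → x≢c e }) hole))))
            (no w≢y , yes refl) → trans (cong ⟦_⟧ (inside xc)) (sym (cong₂ _+_
              (cong₂ (λ a b → ⟦ a ⟧ + ⟦ b ⟧) (only-≢ w≢y) (only-refl c))
              (cong (⟦_⟧ ∘ coloured) (without-same f D? (inj₁ (refl , refl))))))
            (no w≢y , no w≢c) → trans
              (adj-h (λ { (inj₁ (_ , e)) → w≢y e ; (inj₂ (e , _)) → x≢y e })
                     (λ { (inj₁ (_ , e)) → w≢c e ; (inj₂ (e , _)) → x≢c e }))
              (cong₂ (λ a b → ⟦ a ⟧ + ⟦ b ⟧ + ⟦ coloured (h x w) ⟧) (sym (only-≢ w≢y)) (sym (only-≢ w≢c)))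

        other-degree : ∀ {u} → u ≢ x → u ≢ y → u ≢ c → deg G u ≡ count (present h u)
        other-degree {u} u≢x u≢y u≢c = trans
          (degree-formula G (Base.proper base) u (λ _ → 0) λ w →
            adj-h (λ { (inj₁ (e , _)) → u≢x e ; (inj₂ (e , _)) → u≢y e })
                  (λ { (inj₁ (e , _)) → u≢x e ; (inj₂ (e , _)) → u≢c e }))
          (cong (_+ count (present h u)) (sum-zero {n} λ _ → refl))

      clash : ∀ {u i} → u ≢ x → u ≢ y → Missing f x i ⊎ i ≡ b → ¬ Missing f u i
      clash {u} {i} u≢x u≢y i-free ui = case (u ≟ c) , i-free of λ where
          -- The vertex `c` has an edge of colour `b`, and with y and `c` exchanged `y-full` shows
          -- that it misses no colour missing at x.
          (yes refl , inj₂ refl) → ui x (trans (symmetric proper c x) xc)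
          (yes refl , inj₁ xi) → Configurations.y-full (exchange base)
            ((λ { refl → xi c xc }) , without-missing f D? xi) (without-missing f D? ui)
          (no u≢c , _) → no-common-missing u≢x u≢y u≢c (free i-free) (without-missing f D? ui)
        where
        open Counting G ¬colourable degree-sum base (inside ∘ proj₂ ∘ without-inv f D?)
                      x-degree other-degree x-minimal dense using (no-common-missing)
        free : Missing f x i ⊎ i ≡ b → Missing h x i
        free (inj₁ xi) = without-missing f D? xi
        free (inj₂ refl) = Base.xb base

    -- The vertex c exists because `b` occurs at x; otherwise xy could take it.
    no-clash : ∀ {b u i} → Missing f y b → u ≢ x → u ≢ y → Missing f x i ⊎ i ≡ b → ¬ Missing f u i
    no-clash {b} yb with missing? f x b
    ... | inj₁ (c , xc) = clash yb xc
    ... | inj₂ xb = ⊥-elim (ends-disjoint almost ¬colourable xb yb)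

  swap-almost : ∀ {f : Colouring n k} {y p q A} → Almost G f x y → Closed f p q A → Almost G (swapOn p q A f) x y
  swap-almost {f} {y} {p} {q} {A} almost cl = record
    { proper = swapOn-proper proper cl
    ; edge = edge
    ; inside = λ e → [ inside ∘ proj₂ , inside ∘ proj₂ ]′ (swapOn-inv {f = f} {A = A} e)
    ; outside = λ a e → outside a (is-just-false (trans (sym (swapOn-is-just {f = f} {p} {q} {A} _ _)) (cong is-just e)))
    ; hole = is-just-false (trans (swapOn-is-just {f = f} {p} {q} {A} _ _) (cong is-just hole)) }
    where
    open Almost almost

  -- If i is present at x and y, then a vertex missing i lies on the chain of y in the colours b and
  -- i, since swapping these two colours off that chain would make it miss b.
  elementary : ∀ {f : Colouring n k} {y b u v i} → Almost G f x y → Missing f y b → Missing f u i → Missing f v i → u ≡ v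
  elementary {f} {y} {b} {u} {v} {i} almost yb ui vi with missing? f x i | missing? f y i
  ... | inj₂ xi | _ = trans (at-x ui) (sym (at-x vi))
    where
    at-x : ∀ {w} → Missing f w i → w ≡ x
    at-x {w} wi = case (w ≟ x) , (w ≟ y) of λ where
      (yes e , _) → e
      (no _ , yes refl) → ⊥-elim (ends-disjoint almost ¬colourable xi wi)
      (no w≢x , no w≢y) → ⊥-elim (no-clash almost yb w≢x w≢y (inj₁ xi) wi)
  ... | inj₁ (_ , xi) | inj₂ yi = trans (at-y ui) (sym (at-y vi))
    where
    at-y : ∀ {w} → Missing f w i → w ≡ y
    at-y {w} wi = case (w ≟ x) , (w ≟ y) of λ where
      (_ , yes e) → e
      (yes refl , no _) → ⊥-elim (wi _ xi)
      -- Being missing at y, `i` itself plays the part of `b`.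
      (no w≢x , no w≢y) → ⊥-elim (no-clash almost yi w≢x w≢y (inj₂ refl) wi)
  ... | inj₁ (_ , xi) | inj₁ (_ , yi) = otherEnd ch (in-chain ui) (in-chain vi) (≢y ui) (≢y vi) (inj₂ ui) (inj₂ vi)
    where
    open Almost almost
    ch = chain proper b i y (inj₁ yb)
    ≢y : ∀ {w} → Missing f w i → w ≢ y
    ≢y wi refl = wi _ yi
    A : Fin n → Bool
    A = not ∘ member ch
    in-chain : ∀ {w} → Missing f w i → member ch w ≡ true
    in-chain {w} wi with member ch w in w∉
    ... | true = refl
    ... | false = ⊥-elim (no-clash (swap-almost almost λ e j → cong not (closed ch e j))
        (swapOn-missing {f = f} {b} {i} {A} (λ e → contradiction (trans (sym (cong not (start ch))) e) λ ()) (λ _ → yb))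
        (λ { refl → wi _ xi }) (≢y wi) (inj₂ refl)
        (swapOn-missing {f = f} {b} {i} {A} (λ _ → subst (Missing f w) (sym (transpose-left b i)) wi)
                        (λ e → contradiction (trans (sym (cong not w∉)) e) λ ())))

-- Sizes of the colour classes

module _ (G : Graph n) {f : Colouring n k} {x y : Fin n} (almost : Almost G f x y)
  (missing-once : ∀ {u v i} → Missing f u i → Missing f v i → u ≡ v) where
  open Almost almost

  private
    below : Fin n → Fin n → Bool
    below u v = toℕ u <ᵇ toℕ v

    class-size : Fin k → ℕ
    class-size i = sum λ u → count λ v → below u v ∧ hasColour (f u v) i

    -- All vertices but at most one see colour `i`, two for each edge of the class.
    class-bound : ∀ i → n / 2 ≤ class-size i
    class-bound i = begin
      n / 2                       ≤⟨ /-monoˡ-≤ 2 near-perfect ⟩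
      (1 + class-size i * 2) / 2  ≡⟨ half (class-size i) ⟩
      class-size i                ∎
      where
      open ≤-Reasoning
      half : ∀ m → (1 + m * 2) / 2 ≡ m
      half m = trans (+-distrib-/-∣ʳ 1 {m * 2} {2} (divides-refl m)) (m*n/n≡m m 2)
      doubled : count (λ u → present f u i) ≡ class-size i + class-size i
      doubled = trans (sum-cong-≗ {n} λ u → sym (∑-colour-class proper (λ _ → true) u i))
        (handshake (λ u v → hasColour (f u v) i)
          (λ u v → cong (λ m → hasColour m i) (symmetric proper u v))
          (λ u → hasColour-false λ e → adj-≢ almost (inside e) refl))
      near-perfect : n ≤ 1 + class-size i * 2
      near-perfect = begin
        n ≡⟨ count-complement (λ u → present f u i) ⟨
        count (λ u → present f u i) + count (λ u → not (present f u i))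
          ≤⟨ +-mono-≤ (≤-reflexive doubled) (count≤1 (λ u → not (present f u i)) λ e e′ →
               missing-once (absent-missing f (not-true e)) (absent-missing f (not-true e′))) ⟩
        class-size i + class-size i + 1  ≡⟨ +-comm _ 1 ⟩
        1 + (class-size i + class-size i)
          ≡⟨ cong suc (trans (cong (class-size i +_) (sym (+-identityʳ _))) (*-comm 2 (class-size i))) ⟩
        1 + class-size i * 2 ∎

    ∑-classes : sum class-size ≡ sum λ u → count λ v → below u v ∧ coloured (f u v)
    ∑-classes = trans (∑-comm λ i u → count λ v → below u v ∧ hasColour (f u v) i)
      (sum-cong-≗ {n} λ u → trans (∑-comm λ i v → ⟦ below u v ∧ hasColour (f u v) i ⟧)
        (sum-cong-≗ {n} λ v → trans (∑-hasColour (λ _ → below u v) (f u v)) (cong ⟦_⟧ (guard (below u v) (f u v)))))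
      where
      guard : ∀ a (m : Maybe (Fin k)) → colourIn (λ _ → a) m ≡ a ∧ coloured m
      guard a (just _) = sym (∧-identityʳ a)
      guard a nothing = sym (∧-zeroʳ a)

    pointwise : ∀ u v → ⟦ below u v ∧ coloured (f u v) ⟧ ≤ ⟦ below u v ∧ adj G u v ⟧
    pointwise u v with below u v | f u v in e
    ... | false | _ = z≤n
    ... | true | nothing = z≤n
    ... | true | just _ = ≤-reflexive (cong ⟦_⟧ (sym (inside e)))

    uncounted : ∀ {u v} → toℕ u < toℕ v → adj G u v ≡ true → f u v ≡ nothing →
                sum (λ u → count λ v → below u v ∧ coloured (f u v)) < sum (λ u → count λ v → below u v ∧ adj G u v)
    uncounted {u} {v} lt a e = sum-mono-< {n} (λ u → sum-mono {n} (pointwise u)) u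
      (sum-mono-< {n} (pointwise u) v strict)
      where
      strict : ⟦ below u v ∧ coloured (f u v) ⟧ < ⟦ below u v ∧ adj G u v ⟧
      strict rewrite <ᵇ-true lt | e | a = ≤-refl

  overfull : k * (n / 2) < numEdges G
  overfull = begin-strict
    k * (n / 2)                                            ≡⟨ sum-const k (n / 2) ⟨
    sum {k} (λ _ → n / 2)                                  ≤⟨ sum-mono class-bound ⟩
    sum class-size                                         ≡⟨ ∑-classes ⟩
    sum (λ u → count λ v → below u v ∧ coloured (f u v))   <⟨ missing-edge ⟩
    sum (λ u → count λ v → below u v ∧ adj G u v)          ≡⟨ numEdges≡sum G ⟨
    numEdges G                                             ∎
    where
    open ≤-Reasoning
    missing-edge : sum (λ u → count λ v → below u v ∧ coloured (f u v)) < sum (λ u → count λ v → below u v ∧ adj G u v)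
    missing-edge with <-cmp (toℕ x) (toℕ y)
    ... | tri< lt _ _ = uncounted lt edge hole
    ... | tri≈ _ e _ = ⊥-elim (adj-≢ almost edge (toℕ-injective e))
    ... | tri> _ _ gt = uncounted gt (trans (adj-sym G y x) edge) (trans (symmetric proper y x) hole)

-- Consequences of criticality

module _ {G : Graph n} (critical : ΔCritical G) where

  not-colourable : ¬ Colourable (adj G) (maxDeg G)
  not-colourable = proj₂ (proj₁ critical) ∘ toEdgeColouring

  almost-colouring : ∀ {x y} → adj G x y ≡ true → ∃ λ (f : Colouring n (maxDeg G)) → Almost G f x y
  almost-colouring {x} {y} xy = f , record
    { proper = f-proper ; edge = xy
    ; inside = λ e → proj₁ (∧-split (proj₁ (f-just e)))
    ; outside = outside
    ; hole = f-uncoloured xy-removed }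
    where
    R : Fin n → Fin n → Bool
    R u v = adj G u v ∧ not (does (sameEdge? x y u v))
    R-sym : ∀ u v → R u v ≡ R v u
    R-sym u v = cong₂ (λ a b → a ∧ not b) (adj-sym G u v) (case sameEdge? x y u v of λ where
      (yes s) → trans (dec-true (sameEdge? x y u v) s) (sym (dec-true (sameEdge? x y v u) (sameEdge-flip s)))
      (no ¬s) → trans (dec-false (sameEdge? x y u v) ¬s) (sym (dec-false (sameEdge? x y v u) (¬s ∘ sameEdge-flip))))
    xy-removed : R x y ≡ false
    xy-removed = trans (cong (λ a → adj G x y ∧ not a) (dec-true (sameEdge? x y x y) (inj₁ (refl , refl))))
                       (∧-zeroʳ (adj G x y))
    H : Subgraph G
    H = record { V = λ _ → true ; E = R ; E-sym = R-sym
               ; E⊆G = λ u v e → proj₁ (∧-split e) ; E⊆V = λ _ _ _ → refl }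
    open FromEdgeColouring R-sym (proj₂ critical H (inj₂ (x , y , xy , xy-removed)))
    outside : ∀ {u v} → adj G u v ≡ true → f u v ≡ nothing → SameEdge x y u v
    outside {u} {v} a e = case sameEdge? x y u v of λ where
      (yes s) → s
      (no ¬s) → contradiction (trans (sym e) (f-coloured
        (cong₂ (λ a b → a ∧ not b) a (dec-false (sameEdge? x y u v) ¬s)))) λ ()

  -- In a colouring of G - uv each of the Δ colours occurs at `u` or at `v`, and the edge uv adds
  -- one to both degrees.
  adjacent-degrees : ∀ {u v} → adj G u v ≡ true → maxDeg G + 2 ≤ deg G u + deg G v
  adjacent-degrees {u} {v} uv = begin
    maxDeg G + 2                                         ≡⟨ cong (_+ 2) (sum-ones (maxDeg G)) ⟨
    sum {maxDeg G} (λ _ → 1) + 2                         ≤⟨ +-monoˡ-≤ 2 (sum-mono either) ⟩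
    sum (λ i → ⟦ present f u i ⟧ + ⟦ present f v i ⟧) + 2
      ≡⟨ cong (_+ 2) (∑-distrib-+ (λ i → ⟦ present f u i ⟧) (λ i → ⟦ present f v i ⟧)) ⟩
    count (present f u) + count (present f v) + 2        ≡⟨ rearrange (count (present f u)) (count (present f v)) ⟩
    (1 + count (present f u)) + (1 + count (present f v))
      ≡⟨ cong₂ _+_ (end-degree almost) (end-degree (almost-flip almost)) ⟨
    deg G u + deg G v                                    ∎
    where
    open ≤-Reasoning
    f = proj₁ (almost-colouring uv)
    almost = proj₂ (almost-colouring uv)
    rearrange : ∀ a b → a + b + 2 ≡ (1 + a) + (1 + b)
    rearrange = solve-∀
    either : ∀ i → 1 ≤ ⟦ present f u i ⟧ + ⟦ present f v i ⟧
    either i with present f u i in eu | present f v i in ev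
    ... | true | _ = s≤s z≤n
    ... | false | true = s≤s z≤n
    ... | false | false = ⊥-elim (ends-disjoint almost not-colourable (absent-missing f eu) (absent-missing f ev))

  -- The uncoloured edge leaves at most Δ - 1 colours at y.
  some-missing : ∀ {x y} {f : Colouring n (maxDeg G)} → Almost G f x y → ∃ (Missing f y)
  some-missing {y = y} {f} almost =
    let b , e , _ = pick (not ∘ present f y) [] (+-cancelˡ-< (count (present f y)) _ _ (begin-strict
          count (present f y) + 0                      ≡⟨ +-identityʳ _ ⟩
          count (present f y)                          <⟨ n<1+n _ ⟩
          1 + count (present f y)                      ≡⟨ end-degree (almost-flip almost) ⟨
          deg G y                                      ≤⟨ deg≤maxDeg G y ⟩
          maxDeg G                                     ≡⟨ count-complement (present f y) ⟨
          count (present f y) + count (not ∘ present f y) ∎))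
    in b , absent-missing f (not-true e)
    where open ≤-Reasoning

  -- Without edges the empty colouring would do. This also disposes of the graph on no vertices.
  some-edge : ∃₂ λ u v → adj G u v ≡ true
  some-edge with any? (λ u → any? λ v → adj G u v ≟ᵇ true)
  ... | yes (u , v , e) = u , v , e
  ... | no none = ⊥-elim (not-colourable
    ((λ _ _ → nothing) , record { symmetric = λ _ _ → refl ; unique = λ () } , λ u v e → ⊥-elim (none (u , v , e))))

  first-step : ∀ {u v} → Walk G u v → u ≢ v → ∃ λ w → adj G u w ≡ true
  first-step here u≢v = ⊥-elim (u≢v refl)
  first-step (step e _) _ = _ , e

  -- Connectedness enters here: a vertex of minimum degree must have an edge to remove.
  neighbour : Connected G → ∀ x → ∃ λ y → adj G x y ≡ true
  neighbour connected x with u , v , uv ← some-edge = case (x ≟ u) of λ where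
    (yes refl) → v , uv
    (no x≢u) → first-step (connected x u) x≢u

theorem1 : ∀ (n : ℕ) (G : Graph n) → Connected G → ΔCritical G →
    2 * n + 5 * minDeg G ≤ 3 * maxDeg G + 7 →
    maxDeg G * (n / 2) < numEdges G
theorem1 zero G connected critical dense = case some-edge critical of λ ()
theorem1 (suc n) G connected critical dense =
  let x , x-min = minDeg-attained G
      y , xy = neighbour critical connected x
      f , almost = almost-colouring critical xy
      b , yb = some-missing critical almost
      open Extremal G (not-colourable critical) (adjacent-degrees critical)
             (λ u → subst (_≤ deg G u) x-min (minDeg≤deg G u))
             (subst (λ δ → 2 * suc n + 5 * δ ≤ 3 * maxDeg G + 7) x-min dense)
  in overfull G almost (elementary almost yb)
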